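{- Let $T$ be a binary tree with $N$ nodes. Then $$\mathbf P_T(\mathbb X)=\prod_{s}\frac{1}{1-q^{n_s}}\begin{cases}q^{n_s}-q^{n'_s}t&\text{if $s$ is the right son of its father},\\ 1-q^{n'_s}t&\text{otherwise},\end{cases}$$ the product running over all nodes $s$ of $T$, where $n_s$ is the number of nodes of the subtree of $T$ rooted at $s$ and $n'_s$ is the number of nodes of the left subtree of $s$.
   Context: Binary trees: each node has an (possibly empty) left and right subtree. For a word $w$ with distinct integer letters, its decreasing binary tree is empty if $w$ is empty, and otherwise has root labelled by the maximal letter $m$, writing $w=w'mw''$, with left subtree the decreasing tree of $w'$ and right subtree that of $w''$. For $\sigma\in\mathfrak S_N$, $P(\sigma)$ denotes the unlabelled shape of the decreasing binary tree of $\sigma^{ -1}$ (equivalently the shape of the binary search tree of $\sigma$). For $\mu\in\mathfrak S_N$ and $\epsilon\in\{\pm1\}^N$ let $w=(\epsilon_1\mu_1,\dots,\epsilon_N\mu_N)$, $\mathrm{maj}(\mu,\epsilon)=\sum_{i:\,w_i>w_{i+1}}i$, $m(\epsilon)$ the number of $-1$ entries, $(q)_N=\prod_{i=1}^N(1-q^i)$, and $\mathbf F_\mu(\mathbb X)=\frac1{(q)_N}\sum_{\epsilon}(-t)^{m(\epsilon)}q^{\mathrm{maj}(\mu,\epsilon)}$ (the $(q,t)$-specialization of the free quasi-symmetric function $\mathbf F_\mu$ at $\mathbb X=\frac1{1-q}\hat\times(1-t)$). The Loday–Ronco basis element of $\mathbf{PBT}$ is $\mathbf P_T=\sum_{P(\sigma)=T}\mathbf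 F_\sigma$, so $\mathbf P_T(\mathbb X)=\sum_{\sigma\in\mathfrak S_N,\ P(\sigma)=T}\mathbf F_\sigma(\mathbb X)$. -}

module Defs where

open import Level using (Level)
open import Data.Bool using (Bool; true; false; if_then_else_; _∧_)
open import Data.Nat as ℕ using (ℕ; zero; suc; _≡ᵇ_)
open import Data.Integer as ℤ using (ℤ; +_)
import Data.Integer.Properties as ℤP
open import Data.List using (List; []; _∷_; map; concatMap; _++_; length; upTo; foldr)
open import Data.Product using (_×_; _,_)
open import Relation.Nullary using (does)
open import Algebra.Bundles using (CommutativeRing)

data BTree : Set where
  leaf : BTree
  node : BTree → BTree → BTree

size : BTree → ℕ
size leaf = 0
size (node l r) = suc (size l ℕ.+ size r)

_=ᵀ_ : BTree → BTree → Bool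
leaf =ᵀ leaf = true
leaf =ᵀ node _ _ = false
node _ _ =ᵀ leaf = false
node l r =ᵀ node l' r' = (l =ᵀ l') ∧ (r =ᵀ r')

maxL : List ℕ → ℕ
maxL [] = 0
maxL (x ∷ xs) = x ℕ.⊔ maxL xs

splitAt' : ℕ → List ℕ → List ℕ × List ℕ
splitAt' m [] = [] , []
splitAt' m (x ∷ xs) with x ≡ᵇ m
... | true = [] , xs
... | false with splitAt' m xs
...   | (a , b) = (x ∷ a) , b

-- recursion with fuel (fuel ≥ length of the word suffices)
decTreeF : ℕ → List ℕ → BTree
decTreeF zero _ = leaf
decTreeF (suc f) [] = leaf
decTreeF (suc f) (x ∷ xs) with splitAt' (maxL (x ∷ xs)) (x ∷ xs)
... | (w' , w'') = node (decTreeF f w') (decTreeF f w'')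

decTree : List ℕ → BTree
decTree w = decTreeF (length w) w

insertions : ℕ → List ℕ → List (List ℕ)
insertions x [] = (x ∷ []) ∷ []
insertions x (y ∷ ys) = (x ∷ y ∷ ys) ∷ map (y ∷_) (insertions x ys)

perms : ℕ → List (List ℕ)
perms zero = [] ∷ []
perms (suc n) = concatMap (insertions (suc n)) (perms n)

pos : ℕ → List ℕ → ℕ
pos i [] = 0
pos i (x ∷ xs) = if x ≡ᵇ i then 1 else suc (pos i xs)

inverse : ℕ → List ℕ → List ℕ
inverse N σ = map (λ i → pos (suc i) σ) (upTo N)

P : ℕ → List ℕ → BTree
P N σ = decTree (inverse N σ)

-- Sign vectors ε ∈ {±1}^N  (true means ε_i = -1)

signs : ℕ → List (List Bool)
signs zero = [] ∷ []
signs (suc n) = map (false ∷_) (signs n) ++ map (true ∷_) (signs n)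

minusCount : List Bool → ℕ
minusCount [] = 0
minusCount (true ∷ e) = suc (minusCount e)
minusCount (false ∷ e) = minusCount e

signedWord : List ℕ → List Bool → List ℤ
signedWord (x ∷ xs) (true ∷ e) = ℤ.- (+ x) ∷ signedWord xs e
signedWord (x ∷ xs) (false ∷ e) = + x ∷ signedWord xs e
signedWord _ _ = []

majFrom : ℕ → List ℤ → ℕ
majFrom i (a ∷ b ∷ rest) =
  (if does (b ℤP.<? a) then i else 0) ℕ.+ majFrom (suc i) (b ∷ rest)
majFrom i _ = 0

maj : List ℕ → List Bool → ℕ
maj μ ε = majFrom 1 (signedWord μ ε)

module _ {c ℓ : Level} (R : CommutativeRing c ℓ) where
  open CommutativeRing R

  pow : Carrier → ℕ → Carrier
  pow x zero = 1#
  pow x (suc n) = x * pow x n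

  sumR : List Carrier → Carrier
  sumR = foldr _+_ 0#

  qPoch : Carrier → ℕ → Carrier
  qPoch q zero = 1#
  qPoch q (suc n) = qPoch q n * (1# - pow q (suc n))

  -- Σ_ε (-t)^{m(ε)} q^{maj(μ,ε)}   ( = (q)_N · F_μ(X) )
  numF : Carrier → Carrier → ℕ → List ℕ → Carrier
  numF q t N μ =
    sumR (map (λ ε → pow (- t) (minusCount ε) * pow q (maj μ ε)) (signs N))

  -- Σ_{σ ∈ 𝔖_N, P(σ) = T} Σ_ε (-t)^{m(ε)} q^{maj(σ,ε)}  ( = (q)_N · P_T(X) )
  numP : Carrier → Carrier → ℕ → BTree → Carrier
  numP q t N T =
    sumR (map (λ σ → if P N σ =ᵀ T then numF q t N σ else 0#) (perms N))

  denProd : Carrier → BTree → Carrier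
  denProd q leaf = 1#
  denProd q (node l r) =
    (1# - pow q (size (node l r))) * denProd q l * denProd q r

  -- ∏_s (q^{n_s} - q^{n'_s} t  if s is a right son, 1 - q^{n'_s} t otherwise);
  -- the Boolean flag records whether the current node is a right son.
  numProd : Carrier → Carrier → Bool → BTree → Carrier
  numProd q t b leaf = 1#
  numProd q t b (node l r) =
    (if b then pow q (size (node l r)) - pow q (size l) * t
          else 1# - pow q (size l) * t)
    * numProd q t false l * numProd q t true r

{-# OPTIONS --safe #-}
-- P(σ) = node l r says that σ is a shuffle of u and v followed by k, where u has the letters
-- below k and class l, and v has the letters above k and class r.  Sum q^maj over the signed
-- versions of such words, keeping track of a letter z placed after the word.  For fixed
-- signed u and v, the shuffles contribute a Gaussian binomial times the product of the two
-- weights (Garsia–Gessel with a sentinel).  The sentinel of u and v is then ± k: all of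
-- signed u lies strictly between - k and k, so the sign - contributes the factor
-- - q^|u| t, while for v, whose letters exceed k in absolute value, ± k behaves like 0.
-- Hence the sum for T factors over the two subtrees, and right sons are exactly the
-- subtrees whose sentinel behaves like 0, so that a positive root costs an extra q^{n_s}.
module Submission where

open import Defs
open import Level using (Level)
open import Data.Bool using (false)
open import Data.Nat using (ℕ)
open import Relation.Binary.PropositionalEquality using (_≡_)
open import Algebra.Bundles using (CommutativeRing)

open import Function using (_∘_; mk⇔)
open import Data.Bool using (Bool; true; T; if_then_else_)
open import Data.Bool.Properties using (T?)
open import Data.Empty using (⊥-elim)
open import Data.Integer as ℤ using (ℤ; +_; -[1+_]; ∣_∣; +<+; -<+)
import Data.Integer.Properties as ℤP
open import Data.List using (List; []; _∷_; [_]; map; concatMap; _++_; length; applyUpTo; filter; filterᵇ; reverse; _ʳ++_)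
open import Data.List.Membership.Propositional using (_∈_; _∉_; find; lose)
open import Data.List.Membership.Propositional.Properties using (∈-∃++; ∈-++⁺ˡ; ∈-++⁺ʳ; ∈-++⁻; ∈-map⁺; ∈-map⁻; ∈-concatMap⁺; ∈-concatMap⁻; ∈-filter⁺; ∈-filter⁻)
open import Data.List.Membership.Propositional.Properties.WithK using (unique∧set⇒bag)
open import Data.List.Properties using (filter-all; filter-none; filter-++; filter-accept; filter-reject; map-++; map-∘; map-applyUpTo; ∷-injectiveˡ; ∷-injectiveʳ; ++-identityʳ; reverse-involutive; reverse-injective; ʳ++-defn; length-map; length-reverse)
open import Data.List.Relation.Binary.BagAndSetEquality using (∼bag⇒↭)
open import Data.List.Relation.Binary.Permutation.Propositional using (_↭_; ↭⇒↭ₛ; refl; prep; swap; ↭-sym; ↭-trans; ↭-reflexive; module PermutationReasoning)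
open import Data.List.Relation.Binary.Permutation.Propositional.Properties using (∈-resp-↭; ++-comm; All-resp-↭; filter-↭; ++⁺; shift; drop-mid; drop-∷; ↭-empty-inv; ¬x∷xs↭[]; ↭-reverse; ↭-length)
open import Data.List.Relation.Ternary.Interleaving.Propositional using (Interleaving; []; consˡ; consʳ; toPermutation)
import Data.List.Relation.Ternary.Interleaving as Interleaving
open import Data.List.Relation.Unary.All as All using (All; []; _∷_)
import Data.List.Relation.Unary.All.Properties as AllP
open import Data.List.Relation.Unary.AllPairs using (AllPairs; []; _∷_)
open import Data.List.Relation.Unary.Any using (here; there)
open import Data.List.Relation.Unary.Unique.Propositional using (Unique)
import Data.List.Relation.Unary.Unique.Propositional.Properties as Unique
open import Data.Nat as ℕ using (zero; suc; pred; _≤_; _<_; _≡ᵇ_; z≤n; s≤s; _≟_; _<?_)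
import Data.Nat.Properties as ℕP
open import Data.Nat.Properties using (1+n≰n; <-trans; ≤-trans; ⊔-lub; <-asym; <-cmp; <-irrefl; <⇒≢; <⇒≤; m≤m+n; m≤n+m; m≤n⇒m⊔n≡n; m≥n⇒m⊔n≡m; ≡ᵇ⇒≡; ≤-refl; ≤-reflexive)
open import Data.Product using (∃; _×_; _,_; proj₁)
open import Data.Sum using (inj₁; inj₂)
open import Relation.Binary.Definitions using (tri<; tri≈; tri>)
open import Relation.Binary.PropositionalEquality as ≡ using (_≢_; refl; cong; cong₂; subst)
open import Relation.Nullary using (Dec; does; yes; no; ¬_; ¬?)
open import Relation.Nullary.Decidable using (dec-true; dec-false)
open import Data.List.Relation.Binary.Permutation.Setoid.Properties (≡.setoid ℕ) using (Unique-resp-↭)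

private
  variable
    ℓ₁ ℓ₂ : Level
    A : Set ℓ₁
    B : Set ℓ₂

-- Duplicate-free concatenations and intervals of letters

-- Since `g` reads off from any element of a block `f x` the index `x` of that block, blocks of
-- different indices are disjoint.
unique-concatMap : (f : A → List B) (g : B → A) {xs : List A} →
  (∀ {x y} → x ∈ xs → y ∈ f x → g y ≡ x) →
  (∀ {x} → x ∈ xs → Unique (f x)) → Unique xs → Unique (concatMap f xs)
unique-concatMap f g {[]} inv uf [] = []
unique-concatMap f g {x ∷ xs} inv uf (x∉xs ∷ uxs) =
  Unique.++⁺ (uf (here refl)) (unique-concatMap f g (inv ∘ there) (uf ∘ there) uxs) disjoint
  where
  disjoint : ∀ {y} → ¬ (y ∈ f x × y ∈ concatMap f xs)
  disjoint (y∈fx , y∈rest) with find (∈-concatMap⁻ f {xs = xs} y∈rest)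
  ... | x' , x'∈xs , y∈fx' =
    All.lookup x∉xs x'∈xs (≡.trans (≡.sym (inv (here refl) y∈fx)) (inv (there x'∈xs) y∈fx'))


window : ℕ → ℕ → List ℕ
window o zero    = []
window o (suc n) = suc o ∷ window (suc o) n

window-split : ∀ o a b →
  window o (suc (a ℕ.+ b)) ≡ window o a ++ suc (o ℕ.+ a) ∷ window (suc (o ℕ.+ a)) b
window-split o zero    b rewrite ℕP.+-identityʳ o = refl
window-split o (suc a) b rewrite ℕP.+-suc o a = cong (suc o ∷_) (window-split (suc o) a b)

window-∈ : ∀ {k} o n → k ∈ window o n → ∃ λ a → ∃ λ b → n ≡ suc (a ℕ.+ b) × k ≡ suc (o ℕ.+ a)
window-∈ o (suc n) (here refl) = 0 , n , refl , cong suc (≡.sym (ℕP.+-identityʳ o))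
window-∈ o (suc n) (there k∈) with window-∈ (suc o) n k∈
... | a , b , refl , refl = suc a , b , refl , cong suc (≡.sym (ℕP.+-suc o a))

window-> : ∀ o n → All (o <_) (window o n)
window-> o zero    = []
window-> o (suc n) = ≤-refl ∷ All.map (<-trans ≤-refl) (window-> (suc o) n)

window-≤ : ∀ o n → All (_≤ o ℕ.+ n) (window o n)
window-≤ o zero    = []
window-≤ o (suc n) rewrite ℕP.+-suc o n = s≤s (m≤m+n o n) ∷ window-≤ (suc o) n


length-window : ∀ o n → length (window o n) ≡ n
length-window o zero    = refl
length-window o (suc n) = cong suc (length-window (suc o) n)

map-window : ∀ (f : ℕ → A) g o n → (∀ i → g i ≡ f (suc (o ℕ.+ i))) → applyUpTo g n ≡ map f (window o n)
map-window f g o zero    g≗f = refl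
map-window f g o (suc n) g≗f = cong₂ _∷_
  (≡.trans (g≗f 0) (cong (f ∘ suc) (ℕP.+-identityʳ o)))
  (map-window f (g ∘ suc) (suc o) n (λ i → ≡.trans (g≗f (suc i)) (cong (f ∘ suc) (ℕP.+-suc o i))))

-- Enumeration of permutations without repetition

∈-insertions⇒↭ : ∀ {x} ys {zs} → zs ∈ insertions x ys → zs ↭ x ∷ ys
∈-insertions⇒↭ []       (here refl) = refl
∈-insertions⇒↭ (y ∷ ys) (here refl) = refl
∈-insertions⇒↭ (y ∷ ys) (there zs∈) with ∈-map⁻ (y ∷_) zs∈
... | zs' , zs'∈ , refl = ↭-trans (prep y (∈-insertions⇒↭ ys zs'∈)) (swap y _ refl)

insert-∈-insertions : ∀ {x} as bs → as ++ x ∷ bs ∈ insertions x (as ++ bs)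
insert-∈-insertions []       []       = here refl
insert-∈-insertions []       (b ∷ bs) = here refl
insert-∈-insertions (a ∷ as) bs       = there (∈-map⁺ (a ∷_) (insert-∈-insertions as bs))

insertions-unique : ∀ {x} ys → x ∉ ys → Unique (insertions x ys)
insertions-unique []       x∉ = [] ∷ []
insertions-unique {x} (y ∷ ys) x∉ =
  All.tabulate (λ zs∈ eq → ≢-head (∈-map⁻ (y ∷_) zs∈) eq)
  ∷ Unique.map⁺ ∷-injectiveʳ (insertions-unique ys (x∉ ∘ there))
  where
  ≢-head : ∀ {zs} → (∃ λ zs' → zs' ∈ insertions x ys × zs ≡ y ∷ zs') → x ∷ y ∷ ys ≢ zs
  ≢-head (_ , _ , refl) eq = x∉ (here (∷-injectiveˡ eq))

remove : ℕ → List ℕ → List ℕ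
remove x = filter (λ y → ¬? (y ≟ x))

-- Gives the left inverse by which `perms-unique` tells apart the insertions into different
-- permutations.
remove-insertions : ∀ {x} ys {zs} → x ∉ ys → zs ∈ insertions x ys → remove x zs ≡ ys
remove-insertions {x} ys x∉ys zs∈ = go ys x∉ys zs∈
  where
  P? = λ y → ¬? (y ≟ x)
  keep : ∀ {ys} → x ∉ ys → remove x ys ≡ ys
  keep x∉ = filter-all P? (All.tabulate (λ {y} y∈ y≡x → x∉ (subst (_∈ _) y≡x y∈)))
  go : ∀ ys {zs} → x ∉ ys → zs ∈ insertions x ys → remove x zs ≡ ys
  go []       _  (here refl) = filter-reject P? (λ x≢x → x≢x refl)
  go (y ∷ ys) x∉ (here refl) = ≡.trans (filter-reject P? (λ x≢x → x≢x refl)) (keep x∉)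
  go (y ∷ ys) x∉ (there zs∈) with ∈-map⁻ (y ∷_) zs∈
  ... | zs' , zs'∈ , refl =
    ≡.trans (filter-accept P? (λ y≡x → x∉ (here (≡.sym y≡x)))) (cong (y ∷_) (go ys (x∉ ∘ there) zs'∈))

window-suc : ∀ n → window 0 (suc n) ↭ suc n ∷ window 0 n
window-suc n = ↭-trans
  (↭-reflexive (≡.trans (cong (window 0 ∘ suc) (≡.sym (ℕP.+-identityʳ n))) (window-split 0 n 0)))
  (↭-trans (shift (suc n) (window 0 n) []) (prep (suc n) (↭-reflexive (++-identityʳ _))))

perms⇒↭ : ∀ n {σ} → σ ∈ perms n → σ ↭ window 0 n
perms⇒↭ zero    (here refl) = refl
perms⇒↭ (suc n) σ∈ with find (∈-concatMap⁻ (insertions (suc n)) {xs = perms n} σ∈)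
... | τ , τ∈ , σ∈τ =
  ↭-trans (∈-insertions⇒↭ τ σ∈τ) (↭-trans (prep _ (perms⇒↭ n τ∈)) (↭-sym (window-suc n)))

-- Deleting the largest letter leaves a permutation of the smaller ones, listed by induction, and
-- inserting it again at the same place recovers `σ`.
↭⇒perms : ∀ n {σ} → σ ↭ window 0 n → σ ∈ perms n
↭⇒perms zero    σ↭ with refl ← ↭-empty-inv σ↭ = here refl
↭⇒perms (suc n) σ↭ with ∈-∃++ (∈-resp-↭ (↭-sym (↭-trans σ↭ (window-suc n))) (here refl))
... | as , bs , refl = ∈-concatMap⁺ (insertions (suc n)) {xs = perms n}
  (lose (↭⇒perms n (drop-mid as [] (↭-trans σ↭ (window-suc n)))) (insert-∈-insertions as bs))

∉-perms : ∀ n {σ} → σ ∈ perms n → suc n ∉ σ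
∉-perms n σ∈ n∈ = 1+n≰n (All.lookup (window-≤ 0 n) (∈-resp-↭ (perms⇒↭ n σ∈) n∈))

perms-unique : ∀ n → Unique (perms n)
perms-unique zero    = [] ∷ []
perms-unique (suc n) = unique-concatMap (insertions (suc n)) (remove (suc n))
  (λ {τ} τ∈ → remove-insertions τ (∉-perms n τ∈))
  (λ {τ} τ∈ → insertions-unique τ (∉-perms n τ∈))
  (perms-unique n)

-- Shuffles of two words

-- Enumerates the relation `Interleaving`, to be summed over. An empty argument does not stop the
-- recursion at once, so that every clause but the first exposes the first letter by `map`.
shuffles : List A → List A → List (List A)
shuffles []       []       = [] ∷ []
shuffles []       (y ∷ ys) = map (y ∷_) (shuffles [] ys)
shuffles (x ∷ xs) []       = map (x ∷_) (shuffles xs [])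
shuffles (x ∷ xs) (y ∷ ys) = map (x ∷_) (shuffles xs (y ∷ ys)) ++ map (y ∷_) (shuffles (x ∷ xs) ys)

shuffles⇒interleaving : (xs ys : List A) {zs : List A} → zs ∈ shuffles xs ys → Interleaving xs ys zs
shuffles⇒interleaving [] [] (here refl) = []
shuffles⇒interleaving [] (y ∷ ys) zs∈ with ∈-map⁻ (y ∷_) zs∈
... | _ , zs'∈ , refl = consʳ (shuffles⇒interleaving [] ys zs'∈)
shuffles⇒interleaving (x ∷ xs) [] zs∈ with ∈-map⁻ (x ∷_) zs∈
... | _ , zs'∈ , refl = consˡ (shuffles⇒interleaving xs [] zs'∈)
shuffles⇒interleaving (x ∷ xs) (y ∷ ys) zs∈ with ∈-++⁻ (map (x ∷_) (shuffles xs (y ∷ ys))) zs∈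
... | inj₁ ∈ˡ with ∈-map⁻ (x ∷_) ∈ˡ
...   | _ , zs'∈ , refl = consˡ (shuffles⇒interleaving xs (y ∷ ys) zs'∈)
shuffles⇒interleaving (x ∷ xs) (y ∷ ys) zs∈ | inj₂ ∈ʳ with ∈-map⁻ (y ∷_) ∈ʳ
...   | _ , zs'∈ , refl = consʳ (shuffles⇒interleaving (x ∷ xs) ys zs'∈)

interleaving⇒shuffles : {xs ys zs : List A} → Interleaving xs ys zs → zs ∈ shuffles xs ys
interleaving⇒shuffles [] = here refl
interleaving⇒shuffles {xs = x ∷ _} {[]}     (consˡ i) = ∈-map⁺ (x ∷_) (interleaving⇒shuffles i)
interleaving⇒shuffles {xs = x ∷ _} {_ ∷ _}  (consˡ i) = ∈-++⁺ˡ (∈-map⁺ (x ∷_) (interleaving⇒shuffles i))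
interleaving⇒shuffles {xs = []}    {y ∷ _}  (consʳ i) = ∈-map⁺ (y ∷_) (interleaving⇒shuffles i)
interleaving⇒shuffles {xs = x ∷ xs} {y ∷ ys} (consʳ i) =
  ∈-++⁺ʳ (map (x ∷_) (shuffles xs (y ∷ ys))) (∈-map⁺ (y ∷_) (interleaving⇒shuffles i))

-- When the two words share no letter, the first letter of a shuffle shows from which word it was
-- taken.
shuffles-unique : (xs ys : List A) → (∀ {x} → x ∈ xs → x ∉ ys) → Unique (shuffles xs ys)
shuffles-unique []       []       _ = [] ∷ []
shuffles-unique []       (y ∷ ys) d = Unique.map⁺ ∷-injectiveʳ (shuffles-unique [] ys (λ ()))
shuffles-unique (x ∷ xs) []       d = Unique.map⁺ ∷-injectiveʳ (shuffles-unique xs [] (λ _ ()))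
shuffles-unique (x ∷ xs) (y ∷ ys) d = Unique.++⁺
  (Unique.map⁺ ∷-injectiveʳ (shuffles-unique xs (y ∷ ys) (d ∘ there)))
  (Unique.map⁺ ∷-injectiveʳ (shuffles-unique (x ∷ xs) ys (λ x∈ → d x∈ ∘ there)))
  disjoint
  where
  disjoint : ∀ {zs} → ¬ (zs ∈ map (x ∷_) (shuffles xs (y ∷ ys)) × zs ∈ map (y ∷_) (shuffles (x ∷ xs) ys))
  disjoint (∈ˡ , ∈ʳ) with ∈-map⁻ (x ∷_) ∈ˡ | ∈-map⁻ (y ∷_) ∈ʳ
  ... | _ , _ , refl | _ , _ , eq = d (here refl) (here (∷-injectiveˡ eq))

-- Recovers one of two shuffled words when a predicate separates their letters; this yields the
-- inverses used in `sylvester-unique`.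
interleaving-filterˡ : ∀ {p} {P : A → Set p} (P? : ∀ x → Dec (P x)) {xs ys zs : List A} →
  Interleaving xs ys zs → All P xs → All (¬_ ∘ P) ys → filter P? zs ≡ xs
interleaving-filterˡ P? [] _ _ = refl
interleaving-filterˡ P? (consˡ i) (px ∷ pxs) npys =
  ≡.trans (filter-accept P? px) (cong (_ ∷_) (interleaving-filterˡ P? i pxs npys))
interleaving-filterˡ P? (consʳ i) pxs (npy ∷ npys) =
  ≡.trans (filter-reject P? npy) (interleaving-filterˡ P? i pxs npys)

interleaving-AllPairs : ∀ {r} {R : A → A → Set r} {xs ys zs : List A} →
  Interleaving xs ys zs → AllPairs R zs → AllPairs R xs
interleaving-AllPairs [] [] = []
interleaving-AllPairs (consˡ i) (px ∷ pxs) =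
  AllP.++⁻ˡ _ (All-resp-↭ (toPermutation i) px) ∷ interleaving-AllPairs i pxs
interleaving-AllPairs (consʳ i) (_ ∷ pxs) = interleaving-AllPairs i pxs

filter-interleaving : ∀ k γ → k ∉ γ → Interleaving (filter (_<? k) γ) (filter (k <?_) γ) γ
filter-interleaving k []      _  = []
filter-interleaving k (x ∷ γ) k∉ with <-cmp x k
... | tri< x<k _ k≮x
  rewrite filter-accept (_<? k) {xs = γ} x<k | filter-reject (k <?_) {xs = γ} k≮x =
  consˡ (filter-interleaving k γ (k∉ ∘ there))
... | tri≈ _ refl _ = ⊥-elim (k∉ (here refl))
... | tri> x≮k _ k<x
  rewrite filter-reject (_<? k) {xs = γ} x≮k | filter-accept (k <?_) {xs = γ} k<x =
  consʳ (filter-interleaving k γ (k∉ ∘ there))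

-- Sylvester classes

-- The words with letters o + 1, …, o + size t whose binary search tree is t, written backwards:
-- the root of the tree is the last letter, which comes first here.
sylvester : BTree → ℕ → List (List ℕ)
sylvester leaf       o = [ [] ]
sylvester (node l r) o =
  concatMap (λ u → concatMap (λ v → map (k ∷_) (shuffles u v)) (sylvester r k)) (sylvester l o)
  where
  k = suc (o ℕ.+ size l)

-- A view of membership in `sylvester (node l r) o` that can be matched on, in place of the nested
-- `concatMap`.
data Root (l r : BTree) (o : ℕ) : List ℕ → Set where
  root : ∀ {u v γ} → u ∈ sylvester l o → v ∈ sylvester r (suc (o ℕ.+ size l)) →
    Interleaving u v γ → Root l r o (suc (o ℕ.+ size l) ∷ γ)

sylvester⇒root : ∀ l r o {w} → w ∈ sylvester (node l r) o → Root l r o w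
sylvester⇒root l r o w∈
  with u , u∈ , w∈ᵤ ← find (∈-concatMap⁻ _ {xs = sylvester l o} w∈)
  with v , v∈ , w∈ᵥ ← find (∈-concatMap⁻ _ {xs = sylvester r (suc (o ℕ.+ size l))} w∈ᵤ)
  with γ , γ∈ , refl ← ∈-map⁻ (suc (o ℕ.+ size l) ∷_) w∈ᵥ
  = root u∈ v∈ (shuffles⇒interleaving u v γ∈)

root⇒sylvester : ∀ l r o {w} → Root l r o w → w ∈ sylvester (node l r) o
root⇒sylvester l r o (root u∈ v∈ i) =
  ∈-concatMap⁺ _ (lose u∈ (∈-concatMap⁺ _ (lose v∈ (∈-map⁺ _ (interleaving⇒shuffles i)))))

sylvester⇒↭ : ∀ t o {w} → w ∈ sylvester t o → w ↭ window o (size t)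
sylvester⇒↭ leaf       o (here refl) = refl
sylvester⇒↭ (node l r) o w∈ with sylvester⇒root l r o w∈
... | root {u} {v} {γ} u∈ v∈ i = begin
  k ∷ γ                                      ↭⟨ prep k (toPermutation i) ⟩
  k ∷ u ++ v                                 ↭⟨ prep k (++⁺ (sylvester⇒↭ l o u∈) (sylvester⇒↭ r k v∈)) ⟩
  k ∷ window o (size l) ++ window k (size r) ↭⟨ shift k (window o (size l)) _ ⟨
  window o (size l) ++ k ∷ window k (size r) ≡⟨ window-split o (size l) (size r) ⟨
  window o (size (node l r))                 ∎
  where
  open PermutationReasoning
  k = suc (o ℕ.+ size l)

sylvester-> : ∀ t o {w} → w ∈ sylvester t o → All (o <_) w
sylvester-> t o w∈ = All-resp-↭ (↭-sym (sylvester⇒↭ t o w∈)) (window-> o (size t))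

sylvester-≤ : ∀ t o {w} → w ∈ sylvester t o → All (_≤ o ℕ.+ size t) w
sylvester-≤ t o w∈ = All-resp-↭ (↭-sym (sylvester⇒↭ t o w∈)) (window-≤ o (size t))

-- From a word of the class, `u` and `v` are recovered as the subwords of letters below and above
-- `k`, so different pairs give different words; for one pair the shuffles differ because the
-- letters are disjoint.
sylvester-unique : ∀ t o → Unique (sylvester t o)
sylvester-unique leaf       o = [] ∷ []
sylvester-unique (node l r) o =
  unique-concatMap _ (filter (_<? k)) (λ {u} u∈ w∈ → lower u∈ (inner u w∈))
    (λ {u} u∈ → unique-concatMap _ (filter (k <?_)) (λ {v} v∈ w∈ → upper u∈ (v , v∈ , w∈))
      (λ {v} v∈ → Unique.map⁺ ∷-injectiveʳ (shuffles-unique u v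
        (λ x∈u x∈v → <-asym (All.lookup (small u∈) x∈u) (All.lookup (sylvester-> r k v∈) x∈v))))
      (sylvester-unique r k))
    (sylvester-unique l o)
  where
  k = suc (o ℕ.+ size l)
  small : ∀ {u} → u ∈ sylvester l o → All (_< k) u
  small u∈ = All.map s≤s (sylvester-≤ l o u∈)
  Inner : List ℕ → List ℕ → Set
  Inner u w = ∃ λ v → v ∈ sylvester r k × w ∈ map (k ∷_) (shuffles u v)
  inner : ∀ u {w} → w ∈ concatMap (λ v → map (k ∷_) (shuffles u v)) (sylvester r k) → Inner u w
  inner u w∈ = find (∈-concatMap⁻ _ {xs = sylvester r k} w∈)
  lower : ∀ {u w} → u ∈ sylvester l o → Inner u w → filter (_<? k) w ≡ u
  lower {u} u∈ (v , v∈ , w∈) with γ , γ∈ , refl ← ∈-map⁻ (k ∷_) w∈ =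
    ≡.trans (filter-reject (_<? k) (<-irrefl refl))
      (interleaving-filterˡ (_<? k) (shuffles⇒interleaving u v γ∈) (small u∈)
        (All.map <-asym (sylvester-> r k v∈)))
  upper : ∀ {u w} → u ∈ sylvester l o → (i : Inner u w) → filter (k <?_) w ≡ proj₁ i
  upper {u} u∈ (v , v∈ , w∈) with γ , γ∈ , refl ← ∈-map⁻ (k ∷_) w∈ =
    ≡.trans (filter-reject (k <?_) (<-irrefl refl))
      (interleaving-filterˡ (k <?_) (Interleaving.swap (shuffles⇒interleaving u v γ∈))
        (sylvester-> r k v∈) (All.map <-asym (small u∈)))

filter-↭-++ : ∀ {p} {P : ℕ → Set p} (P? : ∀ x → Dec (P x)) {γ xs ys} → γ ↭ xs ++ ys →
  All P xs → All (¬_ ∘ P) ys → filter P? γ ↭ xs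
filter-↭-++ P? {xs = xs} {ys} γ↭ pxs npys = ↭-trans (filter-↭ P? γ↭) (↭-reflexive
  (≡.trans (filter-++ P? xs ys)
    (≡.trans (cong₂ _++_ (filter-all P? pxs) (filter-none P? npys)) (++-identityʳ xs))))

-- The first letter `k` of the reversed word is the root, and the letters below and above `k` form
-- words on the two adjacent windows. The bound `f` carries the recursion, since filtered sublists
-- are not structurally smaller.
sylvester-complete : ∀ f o n {w} → n ≤ f → w ↭ window o n → ∃ λ t → size t ≡ n × w ∈ sylvester t o
sylvester-complete f       o zero    _    w↭ with refl ← ↭-empty-inv w↭ = leaf , refl , here refl
sylvester-complete (suc f) o (suc n) {[]} _ w↭ = ⊥-elim (¬x∷xs↭[] (↭-sym w↭))
sylvester-complete (suc f) o (suc n) {k ∷ γ} (s≤s n≤f) w↭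
  with window-∈ o (suc n) (∈-resp-↭ w↭ (here refl))
... | a , b , refl , refl
  with sylvester-complete f o a (≤-trans (m≤m+n a b) n≤f) u↭
     | sylvester-complete f k b (≤-trans (m≤n+m b a) n≤f) v↭
  where
  lo = window o a
  hi = window k b
  lo<k : All (_< k) lo
  lo<k = All.map s≤s (window-≤ o a)
  k<hi : All (k <_) hi
  k<hi = window-> k b
  γ↭ : γ ↭ lo ++ hi
  γ↭ = drop-∷ (↭-trans w↭ (↭-trans (↭-reflexive (window-split o a b)) (shift k lo hi)))
  u↭ : filter (_<? k) γ ↭ lo
  u↭ = filter-↭-++ (_<? k) γ↭ lo<k (All.map <-asym k<hi)
  v↭ : filter (k <?_) γ ↭ hi
  v↭ = filter-↭-++ (k <?_) (↭-trans γ↭ (++-comm lo hi)) k<hi (All.map <-asym lo<k)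
... | l , refl , u∈ | r , refl , v∈ =
  node l r , refl , root⇒sylvester l r o (root u∈ v∈ (filter-interleaving k γ k∉γ))
  where
  k∉γ : k ∉ γ
  k∉γ k∈ with ∈-++⁻ (window o (size l))
    (∈-resp-↭ (drop-∷ (↭-trans w↭ (↭-trans (↭-reflexive (window-split o (size l) (size r))) (shift k (window o (size l)) _)))) k∈)
  ... | inj₁ k∈lo = 1+n≰n (All.lookup (window-≤ o (size l)) k∈lo)
  ... | inj₂ k∈hi = <-irrefl refl (All.lookup (window-> k (size r)) k∈hi)

-- Decreasing trees of inverse permutations

maxL-split : ∀ xs {m} ys → All (_< m) xs → All (_< m) ys → maxL (xs ++ m ∷ ys) ≡ m
maxL-split []       {m} ys []         ys<m = m≥n⇒m⊔n≡m (maxL≤ ys<m)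
  where
  maxL≤ : ∀ {ys} → All (_< m) ys → maxL ys ≤ m
  maxL≤ []          = z≤n
  maxL≤ (y<m ∷ ys<m) = ⊔-lub (<⇒≤ y<m) (maxL≤ ys<m)
maxL-split (x ∷ xs) ys (x<m ∷ xs<m) ys<m
  rewrite maxL-split xs ys xs<m ys<m = m≤n⇒m⊔n≡n (<⇒≤ x<m)

≡ᵇ-refl : ∀ n → (n ≡ᵇ n) ≡ true
≡ᵇ-refl zero    = refl
≡ᵇ-refl (suc n) = ≡ᵇ-refl n

≢⇒≡ᵇ : ∀ {m n} → m ≢ n → (m ≡ᵇ n) ≡ false
≢⇒≡ᵇ {m} {n} m≢n with m ≡ᵇ n in eq
... | false = refl
... | true  = ⊥-elim (m≢n (≡ᵇ⇒≡ m n (subst T (≡.sym eq) _)))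

splitAt'-split : ∀ xs {m} ys → All (_< m) xs → splitAt' m (xs ++ m ∷ ys) ≡ (xs , ys)
splitAt'-split []       {m} ys [] rewrite ≡ᵇ-refl m = refl
splitAt'-split (x ∷ xs) ys (x<m ∷ xs<m)
  rewrite ≢⇒≡ᵇ (<⇒≢ x<m) | splitAt'-split xs ys xs<m = refl

decTreeF-split : ∀ f xs {m} ys → All (_< m) xs → All (_< m) ys →
  decTreeF (suc f) (xs ++ m ∷ ys) ≡ node (decTreeF f xs) (decTreeF f ys)
decTreeF-split f [] {m} ys xs<m ys<m
  rewrite maxL-split [] ys xs<m ys<m | ≡ᵇ-refl m = refl
decTreeF-split f (x ∷ xs) ys xs<m ys<m
  rewrite maxL-split (x ∷ xs) ys xs<m ys<m | splitAt'-split (x ∷ xs) ys xs<m = refl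

-- Think of `p` as the position of a letter in the word read forwards, so that mapping `p` over the
-- window gives the inverse. The root `k` comes last and has the greatest position, hence it becomes
-- the root of the decreasing tree. As `p` is arbitrary, positions in the full word can be kept when
-- passing to the subwords `u` and `v`.
decTreeF-sylvester : ∀ t o f (p : ℕ → ℕ) {w} → size t ≤ f → w ∈ sylvester t o →
  AllPairs (λ i j → p j < p i) w → decTreeF f (map p (window o (size t))) ≡ t
decTreeF-sylvester leaf       o zero    p _ _ _ = refl
decTreeF-sylvester leaf       o (suc f) p _ _ _ = refl
decTreeF-sylvester (node l r) o (suc f) p (s≤s sz) w∈ w> with sylvester⇒root l r o w∈ | w>
... | root {u} {v} {γ} u∈ v∈ i | γ<k ∷ γ> =
  ≡.trans (cong (decTreeF (suc f)) (≡.trans (cong (map p) (window-split o (size l) (size r)))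
      (map-++ p (window o (size l)) (k ∷ window k (size r)))))
  (≡.trans (decTreeF-split f (map p (window o (size l))) (map p (window k (size r)))
      (AllP.map⁺ (AllP.++⁻ˡ (window o (size l)) below))
      (AllP.map⁺ (AllP.++⁻ʳ (window o (size l)) below)))
    (cong₂ node
      (decTreeF-sylvester l o f p (≤-trans (m≤m+n _ _) sz) u∈ (interleaving-AllPairs i γ>))
      (decTreeF-sylvester r k f p (≤-trans (m≤n+m _ _) sz) v∈ (interleaving-AllPairs (Interleaving.swap i) γ>))))
  where
  k = suc (o ℕ.+ size l)
  below : All (λ j → p j < p k) (window o (size l) ++ window k (size r))
  below = All-resp-↭ (↭-trans (toPermutation i) (++⁺ (sylvester⇒↭ l o u∈) (sylvester⇒↭ r k v∈))) γ<k

pos-≤ : ∀ {i} xs {ys} → i ∈ xs → pos i (xs ++ ys) ≤ length xs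
pos-≤ {i} (x ∷ xs) (here refl) rewrite ≡ᵇ-refl i = s≤s z≤n
pos-≤ {i} (x ∷ xs) (there i∈) with x ≡ᵇ i
... | true  = s≤s z≤n
... | false = s≤s (pos-≤ xs i∈)

pos-split : ∀ {i} xs {ys} → i ∉ xs → pos i (xs ++ i ∷ ys) ≡ suc (length xs)
pos-split {i} []       i∉ rewrite ≡ᵇ-refl i = refl
pos-split {i} (x ∷ xs) i∉ rewrite ≢⇒≡ᵇ {x} {i} (λ x≡i → i∉ (here (≡.sym x≡i))) =
  cong suc (pos-split xs (i∉ ∘ there))

-- The accumulator `ys` keeps the full word fixed while letters are taken off `w`: the reversal of
-- `x ∷ w` onto `ys` is that of `w` onto `x ∷ ys`.
pos-ʳ++ : ∀ {w} ys → Unique w → AllPairs (λ i j → pos j (w ʳ++ ys) < pos i (w ʳ++ ys)) w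
pos-ʳ++ ys [] = []
pos-ʳ++ {x ∷ w} ys (x∉w ∷ uw) = All.tabulate before ∷ pos-ʳ++ (x ∷ ys) uw
  where
  x∉ : x ∉ reverse w
  x∉ x∈ = All.lookup x∉w (∈-resp-↭ (↭-reverse w) x∈) refl
  before : ∀ {j} → j ∈ w → pos j (w ʳ++ x ∷ ys) < pos x (w ʳ++ x ∷ ys)
  before j∈ rewrite ʳ++-defn w {x ∷ ys} | pos-split (reverse w) {ys} x∉ =
    s≤s (pos-≤ (reverse w) (∈-resp-↭ (↭-sym (↭-reverse w)) j∈))

window-unique : ∀ o n → Unique (window o n)
window-unique o zero    = []
window-unique o (suc n) = All.map <⇒≢ (window-> (suc o) n) ∷ window-unique (suc o) n

-- The rewrites present the inverse of `reverse w` as the positions of the letters of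
-- `window 0 (size t)`, so `decTreeF-sylvester` applies; the fuel is the length of that list, which
-- is `size t`.
P-reverse-sylvester : ∀ t {w} → w ∈ sylvester t 0 → P (size t) (reverse w) ≡ t
P-reverse-sylvester t {w} w∈
  rewrite map-applyUpTo (λ i → i) (λ i → pos (suc i) (reverse w)) (size t)
        | map-window (λ i → pos i (reverse w)) (λ i → pos (suc i) (reverse w)) 0 (size t) (λ _ → refl) =
  decTreeF-sylvester t 0 _ (λ i → pos i (reverse w))
    (≤-reflexive (≡.sym (≡.trans (length-map _ (window 0 (size t))) len)))
    w∈ (pos-ʳ++ [] uw)
  where
  len : length (window 0 (size t)) ≡ size t
  len = length-window 0 (size t)
  uw : Unique w
  uw = Unique-resp-↭ (↭⇒↭ₛ (↭-sym (sylvester⇒↭ t 0 w∈))) (window-unique 0 (size t))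

=ᵀ-refl : ∀ t → (t =ᵀ t) ≡ true
=ᵀ-refl leaf       = refl
=ᵀ-refl (node l r) rewrite =ᵀ-refl l = =ᵀ-refl r

=ᵀ⇒≡ : ∀ s t → T (s =ᵀ t) → s ≡ t
=ᵀ⇒≡ leaf       leaf         _ = refl
=ᵀ⇒≡ (node l r) (node l' r') p with l =ᵀ l' in eqˡ | r =ᵀ r' in eqʳ
... | true | true = cong₂ node (=ᵀ⇒≡ l l' (subst T (≡.sym eqˡ) _)) (=ᵀ⇒≡ r r' (subst T (≡.sym eqʳ) _))

-- Two duplicate-free lists with the same elements are permutations of each other. A permutation `σ`
-- of shape `t` lies, reversed, in the class of some `t'` by completeness, and computing its shape
-- there forces `t'` to be `t`.
sylvester-↭ : ∀ t → filterᵇ (λ σ → P (size t) σ =ᵀ t) (perms (size t)) ↭ map reverse (sylvester t 0)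
sylvester-↭ t = ∼bag⇒↭ (unique∧set⇒bag
  (Unique.filter⁺ _ (perms-unique (size t)))
  (Unique.map⁺ reverse-injective (sylvester-unique t 0))
  (mk⇔ to from))
  where
  inClass = λ σ → T? (P (size t) σ =ᵀ t)
  to : ∀ {σ} → σ ∈ filterᵇ (λ σ → P (size t) σ =ᵀ t) (perms (size t)) → σ ∈ map reverse (sylvester t 0)
  to {σ} σ∈ with ∈-filter⁻ inClass {xs = perms (size t)} σ∈
  ... | σ∈perms , Pσ with sylvester-complete (size t) 0 (size t) ≤-refl
                            (↭-trans (↭-reverse σ) (perms⇒↭ (size t) σ∈perms))
  ... | t' , sz , w∈ = subst (_∈ _) (reverse-involutive σ)
          (∈-map⁺ reverse (subst (λ s → reverse σ ∈ sylvester s 0) t'≡t w∈))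
    where
    t'≡t : t' ≡ t
    t'≡t = ≡.trans
      (≡.sym (≡.trans (cong₂ P (≡.sym sz) (≡.sym (reverse-involutive σ))) (P-reverse-sylvester t' w∈)))
      (=ᵀ⇒≡ _ t Pσ)
  from : ∀ {σ} → σ ∈ map reverse (sylvester t 0) → σ ∈ filterᵇ (λ σ → P (size t) σ =ᵀ t) (perms (size t))
  from σ∈ with w , w∈ , refl ← ∈-map⁻ reverse σ∈ = ∈-filter⁺ inClass
    (↭⇒perms (size t) (↭-trans (↭-reverse w) (sylvester⇒↭ t 0 w∈)))
    (subst T (≡.sym (≡.trans (cong (_=ᵀ t) (P-reverse-sylvester t w∈)) (=ᵀ-refl t))) _)

-- The major index read from the end of the word

-- Here `x` stands at position `n` and `z` directly after it.
descentAt : ℕ → ℤ → ℤ → ℕ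
descentAt n z x = if does (z ℤP.<? x) then n else 0

-- rmaj (length w) z w is the major index of (reverse w) followed by z.  The length is
-- a separate argument so that it stays constant in sums over shuffles.
rmaj : ℕ → ℤ → List ℤ → ℕ
rmaj n z []      = 0
rmaj n z (x ∷ w) = descentAt n z x ℕ.+ rmaj (pred n) x w

descentAt-< : ∀ n {z x} → z ℤ.< x → descentAt n z x ≡ n
descentAt-< n {z} {x} z<x rewrite dec-true (z ℤP.<? x) z<x = ≡.refl

descentAt-≮ : ∀ n {z x} → ¬ z ℤ.< x → descentAt n z x ≡ 0
descentAt-≮ n {z} {x} z≮x rewrite dec-false (z ℤP.<? x) z≮x = ≡.refl

majFrom-ʳ++ : ∀ w z ys →
  majFrom 1 (w ʳ++ z ∷ ys) ≡ rmaj (length w) z w ℕ.+ majFrom (suc (length w)) (z ∷ ys)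
majFrom-ʳ++ []      z ys = ≡.refl
majFrom-ʳ++ (x ∷ w) z ys = ≡.trans (majFrom-ʳ++ w x (z ∷ ys))
  (≡.trans (≡.sym (ℕP.+-assoc (rmaj (length w) x w) d _))
    (cong (ℕ._+ majFrom (suc (suc (length w))) (z ∷ ys)) (ℕP.+-comm (rmaj (length w) x w) d)))
  where
  d = descentAt (suc (length w)) z x

-- A sentinel at least as large as every letter creates no descent, so the plain major index is a
-- case of `rmaj`.
majFrom-reverse : ∀ {m} w → All (ℤ._≤ + m) w → majFrom 1 (reverse w) ≡ rmaj (length w) (+ m) w
majFrom-reverse []          []        = ≡.refl
majFrom-reverse {m} (x ∷ w) (x≤m ∷ _) rewrite descentAt-≮ (suc (length w)) (ℤP.≤⇒≯ x≤m) =
  ≡.trans (majFrom-ʳ++ w x []) (ℕP.+-identityʳ _)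

module _ {c ℓ : Level} (R : CommutativeRing c ℓ) where
  open CommutativeRing R hiding (zero) renaming (Carrier to C; refl to ≈-refl)
  open import Relation.Binary.Reasoning.Setoid setoid
  open import Algebra.Properties.Ring ring using (-‿distribˡ-*; -‿distribʳ-*)
  open import Algebra.Solver.Ring.NaturalCoefficients.Default commutativeSemiring
    using (solve; _:=_; _:+_; _:*_; con)

  -- Finite sums in a commutative ring

  ∑ : List A → (A → C) → C
  ∑ xs f = sumR R (map f xs)

  ∑-cong : ∀ (xs : List A) {f g : A → C} → (∀ {x} → x ∈ xs → f x ≈ g x) → ∑ xs f ≈ ∑ xs g
  ∑-cong []       f≈g = ≈-refl
  ∑-cong (x ∷ xs) f≈g = +-cong (f≈g (here ≡.refl)) (∑-cong xs (f≈g ∘ there))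

  ∑-++ : ∀ xs ys (f : A → C) → ∑ (xs ++ ys) f ≈ ∑ xs f + ∑ ys f
  ∑-++ []       ys f = sym (+-identityˡ _)
  ∑-++ (x ∷ xs) ys f = trans (+-congˡ (∑-++ xs ys f)) (sym (+-assoc _ _ _))

  ∑-map : ∀ (g : A → B) xs (f : B → C) → ∑ (map g xs) f ≈ ∑ xs (f ∘ g)
  ∑-map g xs f = reflexive (cong (sumR R) (≡.sym (map-∘ xs)))

  ∑-concatMap : ∀ (g : A → List B) xs (f : B → C) → ∑ (concatMap g xs) f ≈ ∑ xs (λ x → ∑ (g x) f)
  ∑-concatMap g []       f = ≈-refl
  ∑-concatMap g (x ∷ xs) f = trans (∑-++ (g x) _ f) (+-congˡ (∑-concatMap g xs f))

  ∑-+ : ∀ xs (f g : A → C) → ∑ xs (λ x → f x + g x) ≈ ∑ xs f + ∑ xs g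
  ∑-+ []       f g = sym (+-identityˡ 0#)
  ∑-+ (x ∷ xs) f g = trans (+-congˡ (∑-+ xs f g))
    (solve 4 (λ a b c d → (a :+ b) :+ (c :+ d) := (a :+ c) :+ (b :+ d)) ≈-refl _ _ _ _)

  ∑-*ˡ : ∀ xs (f : A → C) e → ∑ xs (λ x → e * f x) ≈ e * ∑ xs f
  ∑-*ˡ []       f e = sym (zeroʳ e)
  ∑-*ˡ (x ∷ xs) f e = trans (+-congˡ (∑-*ˡ xs f e)) (sym (distribˡ _ _ _))

  ∑-↭ : ∀ {xs ys : List A} (f : A → C) → xs ↭ ys → ∑ xs f ≈ ∑ ys f
  ∑-↭ f refl         = ≈-refl
  ∑-↭ f (prep x p)   = +-congˡ (∑-↭ f p)
  ∑-↭ f (swap x y p) = trans (+-congˡ (+-congˡ (∑-↭ f p)))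
    (solve 3 (λ a b c → a :+ (b :+ c) := b :+ (a :+ c)) ≈-refl _ _ _)
  ∑-↭ f (_↭_.trans p p') = trans (∑-↭ f p) (∑-↭ f p')

  ∑-filterᵇ : ∀ (p : A → Bool) xs (f : A → C) →
    ∑ xs (λ x → if p x then f x else 0#) ≈ ∑ (filterᵇ p xs) f
  ∑-filterᵇ p []       f = ≈-refl
  ∑-filterᵇ p (x ∷ xs) f with p x
  ... | true  = +-congˡ (∑-filterᵇ p xs f)
  ... | false = trans (+-identityˡ _) (∑-filterᵇ p xs f)

  -- Powers of `q` and Gaussian binomial coefficients

  module _ (q : C) where

    infix 9 q^_
    q^_ : ℕ → C
    q^_ = pow R q

    q^-+ : ∀ m n → q^ (m ℕ.+ n) ≈ q^ m * q^ n
    q^-+ zero    n = sym (*-identityˡ _)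
    q^-+ (suc m) n = trans (*-congˡ (q^-+ m n)) (sym (*-assoc _ _ _))

    -- qbin a b is the Gaussian binomial coefficient of a + b over a.
    qbin : ℕ → ℕ → C
    qbin zero    b       = 1#
    qbin (suc a) zero    = 1#
    qbin (suc a) (suc b) = qbin a (suc b) + q^ suc a * qbin (suc a) b

    qbin-0ʳ : ∀ a → qbin a 0 ≡ 1#
    qbin-0ʳ zero    = ≡.refl
    qbin-0ʳ (suc a) = ≡.refl

    -- The second of the two q-Pascal recurrences; the first is the definition of `qbin`. Expanding
    -- both terms of the definition by induction and regrouping gives it.
    qbin-pascal′ : ∀ a b → qbin (suc a) (suc b) ≈ q^ suc b * qbin a (suc b) + qbin (suc a) b
    qbin-pascal′ zero    zero    = solve 1 (λ q → con 1 :+ (q :* con 1) :* con 1 := (q :* con 1) :* con 1 :+ con 1) ≈-refl q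
    qbin-pascal′ zero    (suc b) = begin
      1# + q^ 1 * qbin 1 (suc b)           ≈⟨ +-congˡ (*-congˡ (qbin-pascal′ zero b)) ⟩
      1# + q^ 1 * (q^ suc b * 1# + qbin 1 b)
        ≈⟨ solve 3 (λ q p x → con 1 :+ (q :* con 1) :* ((q :* p) :* con 1 :+ x)
             := (q :* (q :* p)) :* con 1 :+ (con 1 :+ (q :* con 1) :* x)) ≈-refl q (q^ b) (qbin 1 b) ⟩
      q^ suc (suc b) * 1# + qbin 1 (suc b) ∎
    qbin-pascal′ (suc a) zero    = begin
      qbin (suc a) 1 + q^ suc (suc a) * 1# ≈⟨ +-congʳ (qbin-pascal′ a zero) ⟩
      (q^ 1 * qbin a 1 + 1#) + q^ suc (suc a) * 1#
        ≈⟨ solve 3 (λ q p x → ((q :* con 1) :* x :+ con 1) :+ (q :* (q :* p)) :* con 1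
             := (q :* con 1) :* (x :+ (q :* p) :* con 1) :+ con 1) ≈-refl q (q^ a) (qbin a 1) ⟩
      q^ 1 * qbin (suc a) 1 + 1#           ∎
    qbin-pascal′ (suc a) (suc b) = begin
      qbin (suc a) (suc (suc b)) + q^ suc (suc a) * qbin (suc (suc a)) (suc b)
        ≈⟨ +-cong (qbin-pascal′ a (suc b)) (*-congˡ (qbin-pascal′ (suc a) b)) ⟩
      (q^ suc (suc b) * x + y) + q^ suc (suc a) * (q^ suc b * y + z)
        ≈⟨ solve 6 (λ q p r x y z →
             ((q :* (q :* r)) :* x :+ y) :+ (q :* (q :* p)) :* ((q :* r) :* y :+ z)
             := (q :* (q :* r)) :* (x :+ (q :* p) :* y) :+ (y :+ (q :* (q :* p)) :* z))
             ≈-refl q (q^ a) (q^ b) x y z ⟩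
      q^ suc (suc b) * qbin (suc a) (suc (suc b)) + qbin (suc (suc a)) (suc b) ∎
      where
      x = qbin a (suc (suc b))
      y = qbin (suc a) (suc b)
      z = qbin (suc (suc a)) b

    -- The quotient formula for Gaussian binomials, multiplied out because `R` is any commutative
    -- ring. Both Pascal terms contain `qPoch R q (a + b + 1)`, and the remaining factors telescope
    -- to the last factor of the right-hand side.
    qbin-qPoch : ∀ a b → qbin a b * (qPoch R q a * qPoch R q b) ≈ qPoch R q (a ℕ.+ b)
    qbin-qPoch zero    b       = trans (*-identityˡ _) (*-identityˡ _)
    qbin-qPoch (suc a) zero    rewrite ℕP.+-identityʳ a = trans (*-identityˡ _) (*-identityʳ _)
    qbin-qPoch (suc a) (suc b) = begin
      (x + p * y) * ((U * d) * (V * e))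
        ≈⟨ solve 7 (λ x p y U d V e → (x :+ p :* y) :* ((U :* d) :* (V :* e))
             := (x :* (U :* (V :* e))) :* d :+ (y :* ((U :* d) :* V)) :* (p :* e)) ≈-refl x p y U d V e ⟩
      (x * (U * (V * e))) * d + (y * ((U * d) * V)) * (p * e)
        ≈⟨ +-cong (*-congʳ (qbin-qPoch a (suc b))) (*-congʳ (qbin-qPoch (suc a) b)) ⟩
      qPoch R q (a ℕ.+ suc b) * d + qPoch R q (suc a ℕ.+ b) * (p * e)
        ≈⟨ +-congˡ (*-congʳ (reflexive (cong (qPoch R q) (≡.sym (ℕP.+-suc a b))))) ⟩
      qPoch R q (a ℕ.+ suc b) * d + qPoch R q (a ℕ.+ suc b) * (p * e)
        ≈⟨ distribˡ _ _ _ ⟨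
      qPoch R q (a ℕ.+ suc b) * (d + p * e)
        ≈⟨ *-congˡ telescope ⟩
      qPoch R q (a ℕ.+ suc b) * (1# - q^ suc (a ℕ.+ suc b)) ∎
      where
      x = qbin a (suc b)
      y = qbin (suc a) b
      U = qPoch R q a
      V = qPoch R q b
      p = q^ suc a
      d = 1# - p
      e = 1# - q^ suc b
      telescope : d + p * e ≈ 1# - q^ (suc a ℕ.+ suc b)
      telescope = begin
        (1# - p) + p * (1# - q^ suc b)         ≈⟨ +-congˡ (distribˡ _ _ _) ⟩
        (1# - p) + (p * 1# + p * - q^ suc b)
          ≈⟨ solve 3 (λ p m r → (con 1 :+ m) :+ (p :* con 1 :+ r) := con 1 :+ ((p :+ m) :+ r)) ≈-refl p (- p) (p * - q^ suc b) ⟩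
        1# + ((p - p) + p * - q^ suc b)        ≈⟨ +-congˡ (+-congʳ (-‿inverseʳ p)) ⟩
        1# + (0# + p * - q^ suc b)             ≈⟨ +-congˡ (+-identityˡ _) ⟩
        1# + p * - q^ suc b                    ≈⟨ +-congˡ (-‿distribʳ-* p _) ⟨
        1# - p * q^ suc b                      ≈⟨ +-congˡ (-‿cong (q^-+ (suc a) (suc b))) ⟨
        1# - q^ (suc a ℕ.+ suc b)              ∎

    -- Major indices of shuffles with a sentinel

    q^rmaj : ℕ → ℤ → List ℤ → C
    q^rmaj n z w = q^ (rmaj n z w)

    δ : ℕ → ℤ → ℤ → C
    δ n z x = q^ (descentAt n z x)

    δ-< : ∀ n {z x} → z ℤ.< x → δ n z x ≈ q^ n
    δ-< n z<x = reflexive (cong q^_ (descentAt-< n z<x))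

    δ-≮ : ∀ n {z x} → ¬ z ℤ.< x → δ n z x ≈ 1#
    δ-≮ n z≮x = reflexive (cong q^_ (descentAt-≮ n z≮x))

    q^rmaj-cons : ∀ n z x w → q^rmaj (suc n) z (x ∷ w) ≈ δ (suc n) z x * q^rmaj n x w
    q^rmaj-cons n z x w = q^-+ (descentAt (suc n) z x) _

    ∑-q^rmaj-cons : ∀ n z x Γ → ∑ (map (x ∷_) Γ) (q^rmaj (suc n) z) ≈ δ (suc n) z x * ∑ Γ (q^rmaj n x)
    ∑-q^rmaj-cons n z x Γ = trans (∑-map (x ∷_) Γ _)
      (trans (∑-cong Γ (λ {w} _ → q^rmaj-cons n z x w)) (∑-*ˡ Γ _ _))

    -- The two summands belong to shuffles whose final letter is `x` or `y`, followed by `z`. Only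
    -- the cyclic order of `x`, `y`, `z` matters: it decides which of the two q-Pascal recurrences
    -- the identity amounts to.
    δ-pascal : ∀ a b {x y} z → x ≢ y →
      δ (suc a ℕ.+ suc b) z x * (qbin a (suc b) * δ (suc b) x y)
        + δ (suc a ℕ.+ suc b) z y * (qbin (suc a) b * δ (suc a) y x)
      ≈ qbin (suc a) (suc b) * (δ (suc a) z x * δ (suc b) z y)
    δ-pascal a b {x} {y} z x≢y with ℤP.<-cmp x y
    ... | tri≈ _ x≡y _ = ⊥-elim (x≢y x≡y)
    ... | tri< x<y _ y≮x = trans
        (+-cong (*-congˡ (*-congˡ (δ-< (suc b) x<y))) (*-congˡ (*-congˡ (δ-≮ (suc a) y≮x)))) go
      where
      X = qbin a (suc b)
      Y = qbin (suc a) b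
      go : δ (suc a ℕ.+ suc b) z x * (X * q^ suc b) + δ (suc a ℕ.+ suc b) z y * (Y * 1#)
        ≈ qbin (suc a) (suc b) * (δ (suc a) z x * δ (suc b) z y)
      go with z ℤP.<? x | z ℤP.<? y
      ... | yes z<x | yes _ = begin
        q^ (suc a ℕ.+ suc b) * (X * q^ suc b) + q^ (suc a ℕ.+ suc b) * (Y * 1#)
          ≈⟨ +-cong (*-congʳ (q^-+ (suc a) (suc b))) (*-congʳ (q^-+ (suc a) (suc b))) ⟩
        (q^ suc a * q^ suc b) * (X * q^ suc b) + (q^ suc a * q^ suc b) * (Y * 1#)
          ≈⟨ solve 4 (λ p r X Y → (p :* r) :* (X :* r) :+ (p :* r) :* (Y :* con 1)
               := (r :* X :+ Y) :* (p :* r)) ≈-refl (q^ suc a) (q^ suc b) X Y ⟩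
        (q^ suc b * X + Y) * (q^ suc a * q^ suc b)
          ≈⟨ *-congʳ (qbin-pascal′ a b) ⟨
        qbin (suc a) (suc b) * (q^ suc a * q^ suc b) ∎
      ... | yes z<x | no z≮y = ⊥-elim (z≮y (ℤP.<-trans z<x x<y))
      ... | no _ | yes _ = begin
        1# * (X * q^ suc b) + q^ (suc a ℕ.+ suc b) * (Y * 1#)
          ≈⟨ +-congˡ (*-congʳ (q^-+ (suc a) (suc b))) ⟩
        1# * (X * q^ suc b) + (q^ suc a * q^ suc b) * (Y * 1#)
          ≈⟨ solve 4 (λ p r X Y → con 1 :* (X :* r) :+ (p :* r) :* (Y :* con 1)
               := (X :+ p :* Y) :* (con 1 :* r)) ≈-refl (q^ suc a) (q^ suc b) X Y ⟩
        qbin (suc a) (suc b) * (1# * q^ suc b) ∎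
      ... | no _ | no _ = begin
        1# * (X * q^ suc b) + 1# * (Y * 1#)
          ≈⟨ solve 3 (λ r X Y → con 1 :* (X :* r) :+ con 1 :* (Y :* con 1)
               := (r :* X :+ Y) :* (con 1 :* con 1)) ≈-refl (q^ suc b) X Y ⟩
        (q^ suc b * X + Y) * (1# * 1#)
          ≈⟨ *-congʳ (qbin-pascal′ a b) ⟨
        qbin (suc a) (suc b) * (1# * 1#) ∎
    ... | tri> x≮y _ y<x = trans
        (+-cong (*-congˡ (*-congˡ (δ-≮ (suc b) x≮y))) (*-congˡ (*-congˡ (δ-< (suc a) y<x)))) go
      where
      X = qbin a (suc b)
      Y = qbin (suc a) b
      go : δ (suc a ℕ.+ suc b) z x * (X * 1#) + δ (suc a ℕ.+ suc b) z y * (Y * q^ suc a)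
        ≈ qbin (suc a) (suc b) * (δ (suc a) z x * δ (suc b) z y)
      go with z ℤP.<? x | z ℤP.<? y
      ... | yes _ | yes _ = begin
        q^ (suc a ℕ.+ suc b) * (X * 1#) + q^ (suc a ℕ.+ suc b) * (Y * q^ suc a)
          ≈⟨ +-cong (*-congʳ (q^-+ (suc a) (suc b))) (*-congʳ (q^-+ (suc a) (suc b))) ⟩
        (q^ suc a * q^ suc b) * (X * 1#) + (q^ suc a * q^ suc b) * (Y * q^ suc a)
          ≈⟨ solve 4 (λ p r X Y → (p :* r) :* (X :* con 1) :+ (p :* r) :* (Y :* p)
               := (X :+ p :* Y) :* (p :* r)) ≈-refl (q^ suc a) (q^ suc b) X Y ⟩
        qbin (suc a) (suc b) * (q^ suc a * q^ suc b) ∎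
      ... | no z≮x | yes z<y = ⊥-elim (z≮x (ℤP.<-trans z<y y<x))
      ... | yes _ | no _ = begin
        q^ (suc a ℕ.+ suc b) * (X * 1#) + 1# * (Y * q^ suc a)
          ≈⟨ +-congʳ (*-congʳ (q^-+ (suc a) (suc b))) ⟩
        (q^ suc a * q^ suc b) * (X * 1#) + 1# * (Y * q^ suc a)
          ≈⟨ solve 4 (λ p r X Y → (p :* r) :* (X :* con 1) :+ con 1 :* (Y :* p)
               := (r :* X :+ Y) :* (p :* con 1)) ≈-refl (q^ suc a) (q^ suc b) X Y ⟩
        (q^ suc b * X + Y) * (q^ suc a * 1#)
          ≈⟨ *-congʳ (qbin-pascal′ a b) ⟨
        qbin (suc a) (suc b) * (q^ suc a * 1#) ∎
      ... | no _ | no _ =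
        solve 3 (λ p X Y → con 1 :* (X :* con 1) :+ con 1 :* (Y :* p)
               := (X :+ p :* Y) :* (con 1 :* con 1)) ≈-refl (q^ suc a) X Y

    -- The sentinel z is what lets the Garsia–Gessel shuffle formula for maj go through by
    -- induction: removing the final letter of a shuffle turns it into the new sentinel.
    ∑-shuffles-q^rmaj : ∀ u v z → (∀ {x} → x ∈ u → x ∉ v) →
      ∑ (shuffles u v) (q^rmaj (length u ℕ.+ length v) z)
        ≈ qbin (length u) (length v) * (q^rmaj (length u) z u * q^rmaj (length v) z v)
    ∑-shuffles-q^rmaj [] [] z d = solve 0 (con 1 :+ con 0 := con 1 :* (con 1 :* con 1)) ≈-refl
    ∑-shuffles-q^rmaj [] (y ∷ v) z d = begin
      ∑ (map (y ∷_) (shuffles [] v)) (q^rmaj (suc (length v)) z)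
        ≈⟨ ∑-q^rmaj-cons (length v) z y (shuffles [] v) ⟩
      δ (suc (length v)) z y * ∑ (shuffles [] v) (q^rmaj (length v) y)
        ≈⟨ *-congˡ (∑-shuffles-q^rmaj [] v y (λ ())) ⟩
      δ (suc (length v)) z y * (1# * (1# * q^rmaj (length v) y v))
        ≈⟨ solve 2 (λ e f → e :* (con 1 :* (con 1 :* f)) := con 1 :* (con 1 :* (e :* f))) ≈-refl _ _ ⟩
      1# * (1# * (δ (suc (length v)) z y * q^rmaj (length v) y v))
        ≈⟨ *-congˡ (*-congˡ (q^rmaj-cons (length v) z y v)) ⟨
      1# * (1# * q^rmaj (suc (length v)) z (y ∷ v)) ∎
    ∑-shuffles-q^rmaj (x ∷ u) [] z d = begin
      ∑ (map (x ∷_) (shuffles u [])) (q^rmaj (suc (length u ℕ.+ 0)) z)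
        ≈⟨ ∑-q^rmaj-cons (length u ℕ.+ 0) z x (shuffles u []) ⟩
      δ (suc (length u ℕ.+ 0)) z x * ∑ (shuffles u []) (q^rmaj (length u ℕ.+ 0) x)
        ≈⟨ *-cong (reflexive (cong (λ n → δ (suc n) z x) (ℕP.+-identityʳ (length u))))
             (∑-shuffles-q^rmaj u [] x (λ _ ())) ⟩
      δ (suc (length u)) z x * (qbin (length u) 0 * (q^rmaj (length u) x u * 1#))
        ≈⟨ *-congˡ (*-congʳ (reflexive (qbin-0ʳ (length u)))) ⟩
      δ (suc (length u)) z x * (1# * (q^rmaj (length u) x u * 1#))
        ≈⟨ solve 2 (λ e f → e :* (con 1 :* (f :* con 1)) := con 1 :* ((e :* f) :* con 1)) ≈-refl _ _ ⟩
      1# * ((δ (suc (length u)) z x * q^rmaj (length u) x u) * 1#)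
        ≈⟨ *-congˡ (*-congʳ (q^rmaj-cons (length u) z x u)) ⟨
      1# * (q^rmaj (suc (length u)) z (x ∷ u) * 1#) ∎
    ∑-shuffles-q^rmaj (x ∷ u) (y ∷ v) z d = begin
      ∑ (map (x ∷_) Γ₁ ++ map (y ∷_) Γ₂) (q^rmaj (suc n) z)
        ≈⟨ ∑-++ (map (x ∷_) Γ₁) _ _ ⟩
      ∑ (map (x ∷_) Γ₁) (q^rmaj (suc n) z) + ∑ (map (y ∷_) Γ₂) (q^rmaj (suc n) z)
        ≈⟨ +-cong (∑-q^rmaj-cons n z x Γ₁) (∑-q^rmaj-cons n z y Γ₂) ⟩
      δ (suc n) z x * ∑ Γ₁ (q^rmaj n x) + δ (suc n) z y * ∑ Γ₂ (q^rmaj n y)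
        ≈⟨ +-cong (*-congˡ (∑-shuffles-q^rmaj u (y ∷ v) x (d ∘ there)))
                  (*-congˡ (trans (∑-cong Γ₂ (λ {w} _ → reflexive (cong (λ n → q^rmaj n y w) (ℕP.+-suc a b))))
                    (∑-shuffles-q^rmaj (x ∷ u) v y (λ x∈ → d x∈ ∘ there)))) ⟩
      δ (suc n) z x * (qbin a (suc b) * (α * q^rmaj (suc b) x (y ∷ v)))
        + δ (suc n) z y * (qbin (suc a) b * (q^rmaj (suc a) y (x ∷ u) * β))
        ≈⟨ +-cong (*-congˡ (*-congˡ (*-congˡ (q^rmaj-cons b x y v))))
                  (*-congˡ (*-congˡ (*-congʳ (q^rmaj-cons a y x u)))) ⟩
      δ (suc n) z x * (qbin a (suc b) * (α * (δ (suc b) x y * β)))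
        + δ (suc n) z y * (qbin (suc a) b * ((δ (suc a) y x * α) * β))
        ≈⟨ solve 8 (λ e X g e' Y g' α β →
             e :* (X :* (α :* (g :* β))) :+ e' :* (Y :* ((g' :* α) :* β))
             := (e :* (X :* g) :+ e' :* (Y :* g')) :* (α :* β)) ≈-refl _ _ _ _ _ _ α β ⟩
      (δ (suc n) z x * (qbin a (suc b) * δ (suc b) x y)
        + δ (suc n) z y * (qbin (suc a) b * δ (suc a) y x)) * (α * β)
        ≈⟨ *-congʳ (δ-pascal a b z (λ x≡y → d (here ≡.refl) (here x≡y))) ⟩
      (qbin (suc a) (suc b) * (δ (suc a) z x * δ (suc b) z y)) * (α * β)
        ≈⟨ solve 5 (λ Q e f α β → (Q :* (e :* f)) :* (α :* β) := Q :* ((e :* α) :* (f :* β))) ≈-refl _ _ _ α β ⟩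
      qbin (suc a) (suc b) * ((δ (suc a) z x * α) * (δ (suc b) z y * β))
        ≈⟨ *-congˡ (*-cong (q^rmaj-cons a z x u) (q^rmaj-cons b z y v)) ⟨
      qbin (suc a) (suc b) * (q^rmaj (suc a) z (x ∷ u) * q^rmaj (suc b) z (y ∷ v)) ∎
      where
      a = length u
      b = length v
      n = a ℕ.+ suc b
      α = q^rmaj a x u
      β = q^rmaj b y v
      Γ₁ = shuffles u (y ∷ v)
      Γ₂ = shuffles (x ∷ u) v

    -- Sums over signs

    module _ (t : C) where

      -- A recursion on letters instead of sign vectors: each negative letter brings its own factor
      -- `- t`, so signs stay attached to letters under reversal and shuffling.
      ∑± : List ℕ → (List ℤ → C) → C
      ∑± []      f = f []
      ∑± (x ∷ w) f = ∑± w (f ∘ (+ x ∷_)) + (- t) * ∑± w (f ∘ ((ℤ.- (+ x)) ∷_))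

      -- The condition on absolute values is how bounds and disjointness of the letters pass to the
      -- signed words.
      ∑±-cong : ∀ w {f g : List ℤ → C} → (∀ w' → map ∣_∣ w' ≡ w → f w' ≈ g w') → ∑± w f ≈ ∑± w g
      ∑±-cong []      f≈g = f≈g [] ≡.refl
      ∑±-cong (x ∷ w) f≈g = +-cong
        (∑±-cong w (λ w' eq → f≈g (+ x ∷ w') (cong (x ∷_) eq)))
        (*-congˡ (∑±-cong w (λ w' eq → f≈g ((ℤ.- (+ x)) ∷ w') (cong₂ _∷_ (ℤP.∣-i∣≡∣i∣ (+ x)) eq))))

      ∑±-+ : ∀ w (f g : List ℤ → C) → ∑± w (λ w' → f w' + g w') ≈ ∑± w f + ∑± w g
      ∑±-+ []      f g = ≈-refl
      ∑±-+ (x ∷ w) f g = trans (+-cong (∑±-+ w _ _) (*-congˡ (∑±-+ w _ _)))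
        (solve 5 (λ τ a b c d → (a :+ b) :+ τ :* (c :+ d) := (a :+ τ :* c) :+ (b :+ τ :* d)) ≈-refl (- t) _ _ _ _)

      ∑±-*ˡ : ∀ w (f : List ℤ → C) e → ∑± w (λ w' → e * f w') ≈ e * ∑± w f
      ∑±-*ˡ []      f e = ≈-refl
      ∑±-*ˡ (x ∷ w) f e = trans (+-cong (∑±-*ˡ w _ e) (*-congˡ (∑±-*ˡ w _ e)))
        (solve 4 (λ τ e a b → e :* a :+ τ :* (e :* b) := e :* (a :+ τ :* b)) ≈-refl (- t) e _ _)

      ∑±-*ʳ : ∀ w (f : List ℤ → C) e → ∑± w (λ w' → f w' * e) ≈ ∑± w f * e
      ∑±-*ʳ w f e = trans (∑±-cong w (λ _ _ → *-comm _ _)) (trans (∑±-*ˡ w f e) (*-comm _ _))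

      ∑±-linear : ∀ w (f g : List ℤ → C) → ∑± w (λ w' → f w' + (- t) * g w') ≈ ∑± w f + (- t) * ∑± w g
      ∑±-linear w f g = trans (∑±-+ w f _) (+-congˡ (∑±-*ˡ w g (- t)))

      -- The weight of a sign does not depend on the position of its letter, so signs may be summed
      -- in the reversed order.
      ∑±-ʳ++ : ∀ w v (f : List ℤ → C) → ∑± (w ʳ++ v) f ≈ ∑± w (λ w' → ∑± v (λ v' → f (w' ʳ++ v')))
      ∑±-ʳ++ []      v f = ≈-refl
      ∑±-ʳ++ (x ∷ w) v f = trans (∑±-ʳ++ w (x ∷ v) f) (∑±-linear w _ _)

      ∑-signs≈∑± : ∀ w (f : List ℤ → C) →
        ∑ (signs (length w)) (λ ε → pow R (- t) (minusCount ε) * f (signedWord w ε)) ≈ ∑± w f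
      ∑-signs≈∑± []      f = trans (+-identityʳ _) (*-identityˡ _)
      ∑-signs≈∑± (x ∷ w) f = begin
        ∑ (map (false ∷_) E ++ map (true ∷_) E) g
          ≈⟨ ∑-++ (map (false ∷_) E) _ g ⟩
        ∑ (map (false ∷_) E) g + ∑ (map (true ∷_) E) g
          ≈⟨ +-cong (∑-map (false ∷_) E g) (∑-map (true ∷_) E g) ⟩
        ∑ E (g ∘ (false ∷_)) + ∑ E (g ∘ (true ∷_))
          ≈⟨ +-cong (∑-signs≈∑± w (f ∘ (+ x ∷_)))
               (trans (∑-cong E (λ _ → *-assoc _ _ _))
                 (trans (∑-*ˡ E _ (- t)) (*-congˡ (∑-signs≈∑± w (f ∘ ((ℤ.- (+ x)) ∷_)))))) ⟩
        ∑± (x ∷ w) f ∎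
        where
        E = signs (length w)
        g = λ ε → pow R (- t) (minusCount ε) * f (signedWord (x ∷ w) ε)

      ∑-∑±-cons : ∀ y Γ (f : List ℤ → C) → ∑ (map (y ∷_) Γ) (λ γ → ∑± γ f)
        ≈ ∑ Γ (λ γ → ∑± γ (f ∘ (+ y ∷_))) + (- t) * ∑ Γ (λ γ → ∑± γ (f ∘ ((ℤ.- (+ y)) ∷_)))
      ∑-∑±-cons y Γ f = trans (∑-map (y ∷_) Γ _) (trans (∑-+ Γ _ _) (+-congˡ (∑-*ˡ Γ _ _)))

      -- Signing a shuffle amounts to shuffling signed words, with the same weight, as every letter
      -- carries its sign along.
      ∑-shuffles-∑± : ∀ u v (f : List ℤ → C) →
        ∑ (shuffles u v) (λ γ → ∑± γ f) ≈ ∑± u (λ u' → ∑± v (λ v' → ∑ (shuffles u' v') f))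
      ∑-shuffles-∑± []      []      f = ≈-refl
      ∑-shuffles-∑± []      (y ∷ v) f = trans (∑-∑±-cons y (shuffles [] v) f)
        (+-cong (step (+ y)) (*-congˡ (step (ℤ.- (+ y)))))
        where
        step : ∀ y' → ∑ (shuffles [] v) (λ γ → ∑± γ (f ∘ (y' ∷_))) ≈ ∑± v (λ v' → ∑ (shuffles [] (y' ∷ v')) f)
        step y' = trans (∑-shuffles-∑± [] v _) (∑±-cong v (λ v' _ → sym (∑-map (y' ∷_) (shuffles [] v') f)))
      ∑-shuffles-∑± (x ∷ u) []      f = trans (∑-∑±-cons x (shuffles u []) f)
        (+-cong (step (+ x)) (*-congˡ (step (ℤ.- (+ x)))))
        where
        step : ∀ x' → ∑ (shuffles u []) (λ γ → ∑± γ (f ∘ (x' ∷_))) ≈ ∑± u (λ u' → ∑ (shuffles (x' ∷ u') []) f)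
        step x' = trans (∑-shuffles-∑± u [] _) (∑±-cong u (λ u' _ → sym (∑-map (x' ∷_) (shuffles u' []) f)))
      ∑-shuffles-∑± (x ∷ u) (y ∷ v) f = begin
        ∑ (map (x ∷_) Γ₁ ++ map (y ∷_) Γ₂) (λ γ → ∑± γ f)
          ≈⟨ ∑-++ (map (x ∷_) Γ₁) _ _ ⟩
        ∑ (map (x ∷_) Γ₁) (λ γ → ∑± γ f) + ∑ (map (y ∷_) Γ₂) (λ γ → ∑± γ f)
          ≈⟨ +-cong (∑-∑±-cons x Γ₁ f) (∑-∑±-cons y Γ₂ f) ⟩
        (∑ Γ₁ (λ γ → ∑± γ (f ∘ (+ x ∷_))) + (- t) * ∑ Γ₁ (λ γ → ∑± γ (f ∘ (x⁻ ∷_))))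
          + (∑ Γ₂ (λ γ → ∑± γ (f ∘ (+ y ∷_))) + (- t) * ∑ Γ₂ (λ γ → ∑± γ (f ∘ (y⁻ ∷_))))
          ≈⟨ +-cong (+-cong (splitY (∑-shuffles-∑± u (y ∷ v) _)) (*-congˡ (splitY (∑-shuffles-∑± u (y ∷ v) _))))
                    (+-cong (∑-shuffles-∑± (x ∷ u) v _) (*-congˡ (∑-shuffles-∑± (x ∷ u) v _))) ⟩
        ((L (+ x) (+ y) + (- t) * L (+ x) y⁻) + (- t) * (L x⁻ (+ y) + (- t) * L x⁻ y⁻))
          + ((M (+ x) (+ y) + (- t) * M x⁻ (+ y)) + (- t) * (M (+ x) y⁻ + (- t) * M x⁻ y⁻))
          ≈⟨ solve 9 (λ τ a b c d e f g h →
               ((a :+ τ :* b) :+ τ :* (c :+ τ :* d)) :+ ((e :+ τ :* f) :+ τ :* (g :+ τ :* h))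
               := ((a :+ e) :+ τ :* (b :+ g)) :+ τ :* ((c :+ f) :+ τ :* (d :+ h)))
               ≈-refl (- t) _ _ _ _ _ _ _ _ ⟩
        ((L (+ x) (+ y) + M (+ x) (+ y)) + (- t) * (L (+ x) y⁻ + M (+ x) y⁻))
          + (- t) * ((L x⁻ (+ y) + M x⁻ (+ y)) + (- t) * (L x⁻ y⁻ + M x⁻ y⁻))
          ≈⟨ +-cong (merge (+ x)) (*-congˡ (merge x⁻)) ⟨
        ∑± (x ∷ u) (λ u' → ∑± (y ∷ v) (λ v' → ∑ (shuffles u' v') f)) ∎
        where
        Γ₁ = shuffles u (y ∷ v)
        Γ₂ = shuffles (x ∷ u) v
        x⁻ = ℤ.- (+ x)
        y⁻ = ℤ.- (+ y)
        -- For signed first letters `x'` and `y'`, `L` collects the shuffles that begin with `x'`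
        -- and `M` those that begin with `y'`; each of the four sign choices needs both.
        L M : ℤ → ℤ → C
        L x' y' = ∑± u (λ u' → ∑± v (λ v' → ∑ (shuffles u' (y' ∷ v')) (f ∘ (x' ∷_))))
        M x' y' = ∑± u (λ u' → ∑± v (λ v' → ∑ (shuffles (x' ∷ u') v') (f ∘ (y' ∷_))))
        splitY : ∀ {s x'} → s ≈ ∑± u (λ u' → ∑± (y ∷ v) (λ v' → ∑ (shuffles u' v') (f ∘ (x' ∷_)))) →
          s ≈ L x' (+ y) + (- t) * L x' y⁻
        splitY s≈ = trans s≈ (∑±-linear u _ _)
        both : ∀ x' y' → ∑± u (λ u' → ∑± v (λ v' → ∑ (shuffles (x' ∷ u') (y' ∷ v')) f)) ≈ L x' y' + M x' y'
        both x' y' = trans (∑±-cong u (λ u' _ → trans (∑±-cong v (λ v' _ →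
            trans (∑-++ (map (x' ∷_) (shuffles u' (y' ∷ v'))) _ f)
              (+-cong (∑-map (x' ∷_) (shuffles u' (y' ∷ v')) f) (∑-map (y' ∷_) (shuffles (x' ∷ u') v') f))))
            (∑±-+ v _ _))) (∑±-+ u _ _)
        merge : ∀ x' → ∑± u (λ u' → ∑± (y ∷ v) (λ v' → ∑ (shuffles (x' ∷ u') v') f))
          ≈ (L x' (+ y) + M x' (+ y)) + (- t) * (L x' y⁻ + M x' y⁻)
        merge x' = trans (∑±-linear u _ _) (+-cong (both x' (+ y)) (*-congˡ (both x' y⁻)))

      -- Signed major index sums of a word

      ∑±maj : ℕ → ℤ → List ℕ → C
      ∑±maj n z w = ∑± w (q^rmaj n z)

      ∑±maj-cons : ∀ n z k γ → ∑±maj (suc n) z (k ∷ γ)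
        ≈ δ (suc n) z (+ k) * ∑±maj n (+ k) γ + (- t) * (δ (suc n) z (ℤ.- (+ k)) * ∑±maj n (ℤ.- (+ k)) γ)
      ∑±maj-cons n z k γ = +-cong (step (+ k)) (*-congˡ (step (ℤ.- (+ k))))
        where
        step : ∀ k' → ∑± γ (λ w → q^rmaj (suc n) z (k' ∷ w)) ≈ δ (suc n) z k' * ∑±maj n k' γ
        step k' = trans (∑±-cong γ (λ w _ → q^rmaj-cons n z k' w)) (∑±-*ˡ γ _ _)

      -- Disjoint absolute values keep signed letters distinct, so the shuffle formula holds for
      -- every signing. The Gaussian binomial depends on the lengths only, and the rest is a product
      -- over `u` and `v`.
      ∑-shuffles-∑±maj : ∀ {a b} u v z → length u ≡ a → length v ≡ b → (∀ {x} → x ∈ u → x ∉ v) →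
        ∑ (shuffles u v) (∑±maj (a ℕ.+ b) z) ≈ qbin a b * (∑±maj a z u * ∑±maj b z v)
      ∑-shuffles-∑±maj {a} {b} u v z refl refl d = begin
        ∑ (shuffles u v) (∑±maj (a ℕ.+ b) z)
          ≈⟨ ∑-shuffles-∑± u v (q^rmaj (a ℕ.+ b) z) ⟩
        ∑± u (λ u' → ∑± v (λ v' → ∑ (shuffles u' v') (q^rmaj (a ℕ.+ b) z)))
          ≈⟨ ∑±-cong u (λ u' equ → ∑±-cong v (λ v' eqv → signed u' v' equ eqv)) ⟩
        ∑± u (λ u' → ∑± v (λ v' → qbin a b * (q^rmaj a z u' * q^rmaj b z v')))
          ≈⟨ ∑±-cong u (λ u' _ → trans (∑±-*ˡ v _ _) (*-congˡ (∑±-*ˡ v _ _))) ⟩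
        ∑± u (λ u' → qbin a b * (q^rmaj a z u' * ∑±maj b z v))
          ≈⟨ trans (∑±-*ˡ u _ _) (*-congˡ (∑±-*ʳ u _ _)) ⟩
        qbin a b * (∑±maj a z u * ∑±maj b z v) ∎
        where
        signed : ∀ u' v' → map ∣_∣ u' ≡ u → map ∣_∣ v' ≡ v →
          ∑ (shuffles u' v') (q^rmaj (a ℕ.+ b) z) ≈ qbin a b * (q^rmaj a z u' * q^rmaj b z v')
        signed u' v' refl refl
          rewrite length-map ∣_∣ u' | length-map ∣_∣ v' =
          ∑-shuffles-q^rmaj u' v' z (λ x∈ y∈ → d (∈-map⁺ ∣_∣ x∈) (∈-map⁺ ∣_∣ y∈))

      -- The sentinel meets only the final letter: `- k` always makes a descent there, at position
      -- `length u`, and `k` never does.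
      ∑±maj-negate : ∀ {k} u → All (ℕ._< k) u →
        ∑±maj (length u) (ℤ.- (+ k)) u ≈ q^ length u * ∑±maj (length u) (+ k) u
      ∑±maj-negate         []      []        = sym (*-identityˡ _)
      -- A letter below the bound makes the bound positive, so its negative computes to `-[1+ k ]`.
      ∑±maj-negate {suc k} (x ∷ u) (x<k ∷ _) = trans
        (trans (∑±maj-cons n -[1+ k ] x u)
          (+-cong (*-congʳ (δ-< (suc n) (-<+ {k} {x}))) (*-congˡ (*-congʳ (δ-< (suc n) (-k<-x x<k))))))
        (trans (solve 4 (λ e τ a b → e :* a :+ τ :* (e :* b) := e :* (con 1 :* a :+ τ :* (con 1 :* b)))
            ≈-refl (q^ suc n) (- t) _ _)
          (*-congˡ (sym (trans (∑±maj-cons n (+ suc k) x u)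
            (+-cong (*-congʳ (δ-≮ (suc n) (ℤP.≤⇒≯ (ℤ.+≤+ (ℕP.<⇒≤ x<k)))))
              (*-congˡ (*-congʳ (δ-≮ (suc n) (ℤP.≤⇒≯ (ℤP.neg-≤-pos {x} {suc k}))))))))))
        where
        n = length u
        -k<-x : x ℕ.< suc k → -[1+ k ] ℤ.< ℤ.- (+ x)
        -k<-x x<k = ℤP.neg-mono-< (+<+ x<k)

      -- Sums over a class and their recursion at the root

      classSum : BTree → ℕ → ℤ → C
      classSum T o z = ∑ (sylvester T o) (∑±maj (size T) z)

      -- The final letter `k` or `- k` becomes the sentinel of both shuffled words. On the left,
      -- `∑±maj-negate` trades `- k` for `k` at the cost of a power of `q`; on the right, the two
      -- sentinels are kept apart for now.
      classSum-node : ∀ l r o z → let k = suc (o ℕ.+ size l) in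
        classSum (node l r) o z ≈ qbin (size l) (size r) *
          (δ (size (node l r)) z (+ k) * (classSum l o (+ k) * classSum r k (+ k))
            + (- t) * (δ (size (node l r)) z (ℤ.- (+ k)) * (q^ size l * (classSum l o (+ k) * classSum r k (ℤ.- (+ k))))))
      classSum-node l r o z = begin
        ∑ (concatMap (λ u → concatMap (λ v → map (k ∷_) (shuffles u v)) Rs) Ls) (∑±maj (suc n) z)
          ≈⟨ ∑-concatMap _ Ls _ ⟩
        ∑ Ls (λ u → ∑ (concatMap (λ v → map (k ∷_) (shuffles u v)) Rs) (∑±maj (suc n) z))
          ≈⟨ ∑-cong Ls (λ {u} u∈ → trans (∑-concatMap _ Rs _) (∑-cong Rs (λ {v} v∈ → pair u∈ v∈))) ⟩
        ∑ Ls (λ u → ∑ Rs (λ v → Q * (d⁺ * (h u * ∑±maj b (+ k) v) + (- t) * (d⁻ * (q^ a * (h u * ∑±maj b k⁻ v))))))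
          ≈⟨ ∑-cong Ls (λ {u} _ → overR (h u)) ⟩
        ∑ Ls (λ u → Q * (d⁺ * (h u * R⁺) + (- t) * (d⁻ * (q^ a * (h u * R⁻)))))
          ≈⟨ ∑-cong Ls (λ {u} _ → solve 8 (λ Q e τ e' p g x y →
               Q :* (e :* (g :* x) :+ τ :* (e' :* (p :* (g :* y))))
               := (Q :* (e :* x :+ τ :* (e' :* (p :* y)))) :* g) ≈-refl Q d⁺ (- t) d⁻ (q^ a) (h u) R⁺ R⁻) ⟩
        ∑ Ls (λ u → (Q * (d⁺ * R⁺ + (- t) * (d⁻ * (q^ a * R⁻)))) * h u)
          ≈⟨ ∑-*ˡ Ls h _ ⟩
        (Q * (d⁺ * R⁺ + (- t) * (d⁻ * (q^ a * R⁻)))) * classSum l o (+ k)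
          ≈⟨ solve 8 (λ Q e τ e' p g x y →
               (Q :* (e :* x :+ τ :* (e' :* (p :* y)))) :* g
               := Q :* (e :* (g :* x) :+ τ :* (e' :* (p :* (g :* y))))) ≈-refl Q d⁺ (- t) d⁻ (q^ a) (classSum l o (+ k)) R⁺ R⁻ ⟩
        Q * (d⁺ * (classSum l o (+ k) * R⁺) + (- t) * (d⁻ * (q^ a * (classSum l o (+ k) * R⁻)))) ∎
        where
        a = size l
        b = size r
        n = a ℕ.+ b
        k = suc (o ℕ.+ a)
        k⁻ = ℤ.- (+ k)
        Ls = sylvester l o
        Rs = sylvester r k
        Q = qbin a b
        d⁺ = δ (suc n) z (+ k)
        d⁻ = δ (suc n) z k⁻
        R⁺ = classSum r k (+ k)
        R⁻ = classSum r k k⁻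
        h : List ℕ → C
        h = ∑±maj a (+ k)
        overR : ∀ g → ∑ Rs (λ v → Q * (d⁺ * (g * ∑±maj b (+ k) v) + (- t) * (d⁻ * (q^ a * (g * ∑±maj b k⁻ v)))))
          ≈ Q * (d⁺ * (g * R⁺) + (- t) * (d⁻ * (q^ a * (g * R⁻))))
        overR g = begin
          ∑ Rs (λ v → Q * (d⁺ * (g * ∑±maj b (+ k) v) + (- t) * (d⁻ * (q^ a * (g * ∑±maj b k⁻ v)))))
            ≈⟨ trans (∑-*ˡ Rs _ Q) (*-congˡ (∑-+ Rs _ _)) ⟩
          Q * (∑ Rs (λ v → d⁺ * (g * ∑±maj b (+ k) v)) + ∑ Rs (λ v → (- t) * (d⁻ * (q^ a * (g * ∑±maj b k⁻ v)))))
            ≈⟨ *-congˡ (+-cong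
                 (trans (∑-*ˡ Rs _ _) (*-congˡ (∑-*ˡ Rs _ _)))
                 (trans (∑-*ˡ Rs _ _) (*-congˡ (trans (∑-*ˡ Rs _ _) (*-congˡ
                   (trans (∑-*ˡ Rs _ _) (*-congˡ (∑-*ˡ Rs _ _)))))))) ⟩
          Q * (d⁺ * (g * R⁺) + (- t) * (d⁻ * (q^ a * (g * R⁻)))) ∎
        pair : ∀ {u v} → u ∈ Ls → v ∈ Rs → ∑ (map (k ∷_) (shuffles u v)) (∑±maj (suc n) z)
          ≈ Q * (d⁺ * (h u * ∑±maj b (+ k) v) + (- t) * (d⁻ * (q^ a * (h u * ∑±maj b k⁻ v))))
        pair {u} {v} u∈ v∈ = begin
          ∑ (map (k ∷_) Γ) (∑±maj (suc n) z)
            ≈⟨ trans (∑-map (k ∷_) Γ _) (∑-cong Γ (λ {γ} _ → ∑±maj-cons n z k γ)) ⟩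
          ∑ Γ (λ γ → d⁺ * ∑±maj n (+ k) γ + (- t) * (d⁻ * ∑±maj n k⁻ γ))
            ≈⟨ trans (∑-+ Γ _ _) (+-cong (∑-*ˡ Γ _ _) (trans (∑-*ˡ Γ _ _) (*-congˡ (∑-*ˡ Γ _ _)))) ⟩
          d⁺ * ∑ Γ (∑±maj n (+ k)) + (- t) * (d⁻ * ∑ Γ (∑±maj n k⁻))
            ≈⟨ +-cong (*-congˡ (split (+ k))) (*-congˡ (*-congˡ (trans (split k⁻) (*-congˡ (*-congʳ negate))))) ⟩
          d⁺ * (Q * (h u * ∑±maj b (+ k) v)) + (- t) * (d⁻ * (Q * ((q^ a * h u) * ∑±maj b k⁻ v)))
            ≈⟨ solve 8 (λ Q e τ e' p g x y →
                 e :* (Q :* (g :* x)) :+ τ :* (e' :* (Q :* ((p :* g) :* y)))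
                 := Q :* (e :* (g :* x) :+ τ :* (e' :* (p :* (g :* y))))) ≈-refl
                 Q d⁺ (- t) d⁻ (q^ a) (h u) (∑±maj b (+ k) v) (∑±maj b k⁻ v) ⟩
          Q * (d⁺ * (h u * ∑±maj b (+ k) v) + (- t) * (d⁻ * (q^ a * (h u * ∑±maj b k⁻ v)))) ∎
          where
          Γ = shuffles u v
          lenu : length u ≡ a
          lenu = ≡.trans (↭-length (sylvester⇒↭ l o u∈)) (length-window o a)
          lenv : length v ≡ b
          lenv = ≡.trans (↭-length (sylvester⇒↭ r k v∈)) (length-window k b)
          u<k : All (ℕ._< k) u
          u<k = All.map s≤s (sylvester-≤ l o u∈)
          split : ∀ z → ∑ Γ (∑±maj n z) ≈ Q * (∑±maj a z u * ∑±maj b z v)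
          split z = ∑-shuffles-∑±maj u v z lenu lenv (λ x∈u x∈v →
            ℕP.<-asym (All.lookup u<k x∈u) (All.lookup (sylvester-> r k v∈) x∈v))
          negate : ∑±maj a k⁻ u ≈ q^ a * h u
          negate = subst (λ m → ∑±maj m k⁻ u ≈ q^ m * ∑±maj m (+ k) u) lenu (∑±maj-negate u u<k)

      -- Factorization over the nodes of the tree

      -- A left subtree sees a sentinel above all its signed letters; a right subtree sees one
      -- smaller in absolute value than all its letters, of either sign.
      Bound : Bool → BTree → ℕ → ℤ → Set
      Bound false T o z = + (o ℕ.+ size T) ℤ.< z
      Bound true  T o z = ∣ z ∣ ℕ.≤ o

      rootFactor : Bool → BTree → BTree → C
      rootFactor b l r = if b then q^ size (node l r) - q^ size l * t else 1# - q^ size l * t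

      -- A negative root never exceeds the sentinel, so it makes no descent. A positive root makes
      -- one exactly when the sentinel is that of a right son, and its position is the size of the
      -- subtree.
      rootFactor-δ : ∀ b l r o z → Bound b (node l r) o z → let k = suc (o ℕ.+ size l) in
        δ (size (node l r)) z (+ k) + (- t) * (δ (size (node l r)) z (ℤ.- (+ k)) * q^ size l)
          ≈ rootFactor b l r
      rootFactor-δ b l r o z bd = trans
        (+-congˡ (trans (*-congˡ (trans (*-congʳ (δ-≮ N (z≮-k b bd))) (*-identityˡ _)))
          (trans (sym (-‿distribˡ-* t _)) (-‿cong (*-comm t _)))))
        (head b bd)
        where
        N = size (node l r)
        k = suc (o ℕ.+ size l)
        below : ∀ {z} → + (o ℕ.+ N) ℤ.< z → + k ℤ.≤ z
        below o+N<z = ℤP.≤-trans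
          (ℤ.+≤+ (ℕP.≤-trans (s≤s (ℕP.+-monoʳ-≤ o (ℕP.m≤m+n (size l) (size r)))) (ℕP.≤-reflexive (≡.sym (ℕP.+-suc o _)))))
          (ℤP.<⇒≤ o+N<z)
        inside : ∀ z → ∣ z ∣ ℕ.≤ o → z ℤ.< + k
        inside (+ m)    m≤o = +<+ (s≤s (ℕP.≤-trans m≤o (ℕP.m≤m+n o (size l))))
        inside -[1+ m ] _   = -<+
        z≮-k : ∀ b → Bound b (node l r) o z → ¬ z ℤ.< ℤ.- (+ k)
        z≮-k false o+N<z z<-k = ℤP.<⇒≱ z<-k (ℤP.≤-trans (ℤP.neg-≤-pos {k} {k}) (below o+N<z))
        -- Negation reduces this to `inside` at `- z`, which has the same absolute value as `z`.
        z≮-k true  ∣z∣≤o z<-k = ℤP.<-asym z<-k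
          (subst (ℤ.- (+ k) ℤ.<_) (ℤP.neg-involutive z) (ℤP.neg-mono-< (inside (ℤ.- z)
            (subst (ℕ._≤ o) (≡.sym (ℤP.∣-i∣≡∣i∣ z)) ∣z∣≤o))))
        head : ∀ b → Bound b (node l r) o z → δ N z (+ k) - q^ size l * t ≈ rootFactor b l r
        head false o+N<z = +-congʳ (δ-≮ N (ℤP.≤⇒≯ (below o+N<z)))
        head true  ∣z∣≤o = +-congʳ (δ-< N (inside z ∣z∣≤o))

      -- Induction on the tree, for both kinds of sentinel at once. The right-hand side does not
      -- mention `z`, so the class sum, once multiplied by `denProd`, depends on the sentinel only
      -- through `b`.
      denProd-classSum : ∀ b T o z → Bound b T o z →
        denProd R q T * classSum T o z ≈ qPoch R q (size T) * numProd R q t b T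
      denProd-classSum b leaf       o z bd = *-congˡ (+-identityʳ _)
      denProd-classSum b (node l r) o z bd = begin
        ((D * Dl) * Dr) * classSum (node l r) o z
          ≈⟨ *-congˡ (classSum-node l r o z) ⟩
        ((D * Dl) * Dr) * (Q * (d⁺ * (Gl * classSum r k (+ k)) + (- t) * (d⁻ * (q^ size l * (Gl * classSum r k k⁻)))))
          ≈⟨ solve 11 (λ D Dl Dr Q e g x τ e' p y →
               ((D :* Dl) :* Dr) :* (Q :* (e :* (g :* x) :+ τ :* (e' :* (p :* (g :* y)))))
               := (D :* Q) :* ((Dl :* g) :* (e :* (Dr :* x) :+ τ :* ((e' :* p) :* (Dr :* y))))) ≈-refl
               D Dl Dr Q d⁺ Gl (classSum r k (+ k)) (- t) d⁻ (q^ size l) (classSum r k k⁻) ⟩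
        (D * Q) * ((Dl * Gl) * (d⁺ * (Dr * classSum r k (+ k)) + (- t) * ((d⁻ * q^ size l) * (Dr * classSum r k k⁻))))
          -- The left subtree gets the sentinel `k`, one above its largest letter. For the right
          -- subtree, `k` and `- k` give the same value after multiplication by `Dr`, which becomes
          -- a common factor of the two signs of the root.
          ≈⟨ *-congˡ (*-cong (denProd-classSum false l o (+ k) (+<+ ℕP.≤-refl))
               (+-cong (*-congˡ (denProd-classSum true r k (+ k) ℕP.≤-refl))
                 (*-congˡ (*-congˡ (denProd-classSum true r k k⁻ (ℕP.≤-reflexive (ℤP.∣-i∣≡∣i∣ (+ k)))))))) ⟩
        (D * Q) * ((Pl * Nl) * (d⁺ * (Pr * Nr) + (- t) * ((d⁻ * q^ size l) * (Pr * Nr))))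
          ≈⟨ solve 9 (λ D Q Pl Nl e Pr Nr τ m →
               (D :* Q) :* ((Pl :* Nl) :* (e :* (Pr :* Nr) :+ τ :* (m :* (Pr :* Nr))))
               := ((Q :* (Pl :* Pr)) :* D) :* (((e :+ τ :* m) :* Nl) :* Nr)) ≈-refl
               D Q Pl Nl d⁺ Pr Nr (- t) (d⁻ * q^ size l) ⟩
        ((Q * (Pl * Pr)) * D) * (((d⁺ + (- t) * (d⁻ * q^ size l)) * Nl) * Nr)
          ≈⟨ *-cong (*-congʳ (qbin-qPoch (size l) (size r)))
               (*-congʳ (*-congʳ (rootFactor-δ b l r o z bd))) ⟩
        qPoch R q (size (node l r)) * numProd R q t b (node l r) ∎
        where
        k = suc (o ℕ.+ size l)
        k⁻ = ℤ.- (+ k)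
        D = 1# - q^ size (node l r)
        Dl = denProd R q l
        Dr = denProd R q r
        Q = qbin (size l) (size r)
        d⁺ = δ (size (node l r)) z (+ k)
        d⁻ = δ (size (node l r)) z k⁻
        Gl = classSum l o (+ k)
        Pl = qPoch R q (size l)
        Pr = qPoch R q (size r)
        Nl = numProd R q t false l
        Nr = numProd R q t true r

      -- From permutations and sign vectors to class sums

      -- A bound `m` on the absolute values is a harmless sentinel for every signing at once.
      numF-reverse≈∑±maj : ∀ {m} w → All (ℕ._≤ m) w → numF R q t (length w) (reverse w) ≈ ∑±maj (length w) (+ m) w
      numF-reverse≈∑±maj {m} w w≤m = begin
        numF R q t (length w) (reverse w)
          ≈⟨ reflexive (cong (λ n → numF R q t n (reverse w)) (≡.sym (length-reverse w))) ⟩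
        numF R q t (length (reverse w)) (reverse w)
          ≈⟨ ∑-signs≈∑± (reverse w) (λ w' → q^ majFrom 1 w') ⟩
        ∑± (reverse w) (λ w' → q^ majFrom 1 w')
          ≈⟨ ∑±-ʳ++ w [] _ ⟩
        ∑± w (λ w' → q^ majFrom 1 (reverse w'))
          ≈⟨ ∑±-cong w (λ { w' refl → reflexive (cong q^_ (≡.trans
               (majFrom-reverse w' (All.map ≤m (AllP.map⁻ w≤m)))
               (cong (λ n → rmaj n (+ m) w') (≡.sym (length-map ∣_∣ w'))))) }) ⟩
        ∑±maj (length w) (+ m) w ∎
        where
        ≤m : ∀ {x} → ∣ x ∣ ℕ.≤ m → x ℤ.≤ + m
        ≤m {+ n}      n≤m = ℤ.+≤+ n≤m
        ≤m { -[1+ n ]} _  = ℤ.-≤+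

      -- The sentinel is one more than the largest letter because `Bound false` is strict.
      numP≈classSum : ∀ T → numP R q t (size T) T ≈ classSum T 0 (+ suc (size T))
      numP≈classSum T = begin
        ∑ (perms N) (λ σ → if P N σ =ᵀ T then numF R q t N σ else 0#)
          ≈⟨ ∑-filterᵇ (λ σ → P N σ =ᵀ T) (perms N) _ ⟩
        ∑ (filterᵇ (λ σ → P N σ =ᵀ T) (perms N)) (numF R q t N)
          ≈⟨ ∑-↭ _ (sylvester-↭ T) ⟩
        ∑ (map reverse (sylvester T 0)) (numF R q t N)
          ≈⟨ ∑-map reverse (sylvester T 0) _ ⟩
        ∑ (sylvester T 0) (λ w → numF R q t N (reverse w))
          ≈⟨ ∑-cong (sylvester T 0) (λ {w} w∈ →
               subst (λ n → numF R q t n (reverse w) ≈ ∑±maj n (+ suc N) w)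
                 (≡.trans (↭-length (sylvester⇒↭ T 0 w∈)) (length-window 0 N))
                 (numF-reverse≈∑±maj w (All.map ℕP.m≤n⇒m≤1+n (sylvester-≤ T 0 w∈)))) ⟩
        classSum T 0 (+ suc N) ∎
        where
        N = size T

theorem5p2 : {c ℓ : Level} (R : CommutativeRing c ℓ) (q t : CommutativeRing.Carrier R)
    (N : ℕ) (T : BTree) → size T ≡ N →
    CommutativeRing._≈_ R
    (CommutativeRing._*_ R (denProd R q T) (numP R q t N T))
    (CommutativeRing._*_ R (qPoch R q N) (numProd R q t false T))
theorem5p2 R q t N T refl =
  -- The root of the whole tree is not a right son, hence the flag `false`.
  trans (*-congˡ (numP≈classSum R q t T)) (denProd-classSum R q t false T 0 (+ suc N) (+<+ ℕP.≤-refl))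
  where
  open CommutativeRing R
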